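{- Let $n$ be a positive integer and let $T$ be an equilateral triangle of side length strictly greater than $n$. Then $T$ cannot be covered by $n^2+1$ equilateral triangles of side length $1$ each of which is homothetic to $T$.
   Context: Here a triangle is homothetic to $T$ if it is the image of $T$ under a homothety with positive or negative ratio; equivalently, an equilateral triangle homothetic to $T$ has its sides parallel to the sides of $T$ (it is either a translate of a scaled copy of $T$, or of the point reflection of $T$). "Cover" means the union of the small triangles contains $T$. -}

module Defs where

open import Data.Nat using (ℕ; zero; suc)
open import Data.Fin using (Fin)
open import Data.Product using (Σ; ∃; _×_; _,_)
open import Data.Sum using (_⊎_)
open import Data.Empty using (⊥)
open import Relation.Nullary using (¬_)
open import Relation.Binary.PropositionalEquality using (_≡_)
open import Level using (suc; zero)

-- The real numbers, axiomatised as a complete ordered field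
-- (unique up to isomorphism, so this is a faithful model of ℝ).
record RealField : Set₁ where
  infixl 6 _+_
  infixl 7 _*_
  infix  8 -_
  infix  4 _<_ _≤_
  field
    Carrier : Set
    _+_ _*_ : Carrier → Carrier → Carrier
    -_      : Carrier → Carrier
    0# 1#   : Carrier
    _<_     : Carrier → Carrier → Set
    +-assoc   : ∀ x y z → (x + y) + z ≡ x + (y + z)
    +-comm    : ∀ x y → x + y ≡ y + x
    +-identityˡ : ∀ x → 0# + x ≡ x
    -‿inverseˡ : ∀ x → (- x) + x ≡ 0#
    *-assoc   : ∀ x y z → (x * y) * z ≡ x * (y * z)
    *-comm    : ∀ x y → x * y ≡ y * x
    *-identityˡ : ∀ x → 1# * x ≡ x
    distribˡ  : ∀ x y z → x * (y + z) ≡ (x * y) + (x * z)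
    0≢1       : ¬ (0# ≡ 1#)
    *-inverse : ∀ x → ¬ (x ≡ 0#) → ∃ λ y → x * y ≡ 1#
    <-irrefl  : ∀ x → ¬ (x < x)
    <-trans   : ∀ {x y z} → x < y → y < z → x < z
    <-trichotomy : ∀ x y → (x < y) ⊎ ((x ≡ y) ⊎ (y < x))
    +-mono-<  : ∀ {x y} z → x < y → x + z < y + z
    *-pos     : ∀ {x y} → 0# < x → 0# < y → 0# < x * y
    sup : (P : Carrier → Set) → (∃ λ x → P x) →
          (∃ λ b → ∀ x → P x → (x < b ⊎ x ≡ b)) →
          ∃ λ s → (∀ x → P x → (x < s ⊎ x ≡ s)) ×
                  (∀ b → (∀ x → P x → (x < b ⊎ x ≡ b)) → (s < b ⊎ s ≡ b))

  _≤_ : Carrier → Carrier → Set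
  x ≤ y = x < y ⊎ x ≡ y

  _-_ : Carrier → Carrier → Carrier
  x - y = x + (- y)

  fromℕ : ℕ → Carrier
  fromℕ zero = 0#
  fromℕ (suc n) = 1# + fromℕ n

  Point : Set
  Point = Carrier × Carrier

  dist² : Point → Point → Carrier
  dist² (x₁ , y₁) (x₂ , y₂) = (x₁ - x₂) * (x₁ - x₂) + (y₁ - y₂) * (y₁ - y₂)

  InTriangle : Point → Point → Point → Point → Set
  InTriangle (a₁ , a₂) (b₁ , b₂) (c₁ , c₂) (p₁ , p₂) =
    Σ Carrier λ α → Σ Carrier λ β → Σ Carrier λ γ →
      (0# ≤ α) × (0# ≤ β) × (0# ≤ γ) × (α + β + γ ≡ 1#) ×
      (p₁ ≡ α * a₁ + β * b₁ + γ * c₁) × (p₂ ≡ α * a₂ + β * b₂ + γ * c₂)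

  homothety : Carrier → Point → Point → Point
  homothety l (t₁ , t₂) (x₁ , x₂) = (l * x₁ + t₁ , l * x₂ + t₂)

{-# OPTIONS --safe #-}

-- Subdivide the sides of T into M equal parts, where M is slightly larger than n N but a unit
-- triangle still has side less than N parts. A unit triangle then has at most
-- N + (N - 1) + … + 1 lattice points, one row for each residue modulo N, and on the row of
-- residue r their number is congruent to ± r + const modulo N. For each r let h(r) ≥ 0 be
-- the sum of these numbers over all n² + 1 triangles minus the number of lattice points of T
-- on the rows of residue r. On all residues that occur exactly n times among the rows of T,
-- h(r) is an affine function of r modulo N, with slope n - Σ ± 1. As n² + 1 and n have
-- different parity, the slope is odd, so if N is a power of 2 the values h(r) are distinct
-- natural numbers and their sum is about N² / 2 or more. For large N this exceeds the sum of
-- all h(r), the difference of the total point counts, which the excess of M over n N pulls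
-- below N² / 2.
module Submission where

open import Defs
open import Data.Nat using (ℕ; _≤_; _*_; _+_; zero; suc; _<_; _∸_; _^_; NonZero; z≤n; s≤s; _≤?_)
open import Data.Nat.Properties
open import Data.Nat.Divisibility using (>⇒∤; _∣0) renaming (_∣_ to _ℕ∣_)
open import Data.Nat.Tactic.RingSolver using (solve-∀)
open import Data.Integer using (ℤ; +_; -[1+_]; ∣_∣; 0ℤ; 1ℤ; -1ℤ)
import Data.Integer as ℤ
import Data.Integer.Properties as ℤ
open import Data.Integer.Divisibility.Signed
  using (_∣_; divides; ∣-trans; ∣⇒∣ᵤ; ∣m∣n⇒∣m+n; ∣m∣n⇒∣m-n; ∣m⇒∣-m; ∣m+n∣m⇒∣n; *-cancelˡ-∣; *-monoʳ-∣)
open import Data.Integer.DivMod using (_%ℕ_; _/ℕ_; n%ℕd<d; a≡a%ℕn+[a/ℕn]*n)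
import Data.Integer.Tactic.RingSolver as ℤ-Solver
open import Data.Fin using (Fin; zero; suc; toℕ; fromℕ<; punchIn; splitAt; _↑ˡ_; _↑ʳ_)
open import Data.Fin.Properties using (toℕ<n; toℕ-injective; toℕ-fromℕ<; punchIn-injective; any?;
  <⇒notInjective; injective⇒≤; splitAt⁻¹-↑ˡ; splitAt⁻¹-↑ʳ; splitAt-↑ˡ; splitAt-↑ʳ)
open import Data.Maybe using (Maybe; just; nothing)
open import Data.Product using (Σ; ∃; _×_; _,_; proj₁; proj₂)
open import Data.Product.Properties using (,-injective)
open import Data.Sum using (_⊎_; inj₁; inj₂)
open import Function using (_∘_)
open import Function.Definitions using (Injective)
open import Level using (0ℓ)
open import Relation.Nullary using (¬_; Dec; yes; no; contradiction)
open import Relation.Binary.PropositionalEquality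
open import Relation.Unary using (Decidable)
open import Algebra.Bundles using (CommutativeRing)
open import Algebra.Consequences.Propositional using (comm∧idˡ⇒id; comm∧invˡ⇒inv; comm∧distrˡ⇒distrʳ)
open import Algebra.Properties.Semiring.Sum +-*-semiring
  using (sum; sum-syntax; ∑-distrib-+; ∑-comm; sum-remove; sum-cong-≗; *-distribˡ-sum)
import Algebra.Properties.Ring
import Algebra.Solver.Ring
open import Algebra.Solver.Ring.AlmostCommutativeRing
  using (AlmostCommutativeRing; fromCommutativeRing; _-Raw-AlmostCommutative⟶_)

-- Finite sums and triangle numbers.

sum-mono : ∀ {n} {f g : Fin n → ℕ} → (∀ i → f i ≤ g i) → sum f ≤ sum g
sum-mono {zero}  f≤g = z≤n
sum-mono {suc n} f≤g = +-mono-≤ (f≤g zero) (sum-mono (f≤g ∘ suc))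

sum-const : ∀ n c → (∑[ i < n ] c) ≡ n * c
sum-const zero    c = refl
sum-const (suc n) c = cong (_+_ c) (sum-const n c)

sum-tail-≤ : ∀ E F (f : ℕ → ℕ) → ∑[ j < F ] f (E + toℕ j) ≤ ∑[ r < E + F ] f (toℕ r)
sum-tail-≤ zero    F f = ≤-refl
sum-tail-≤ (suc E) F f = ≤-trans (sum-tail-≤ E F (f ∘ suc)) (m≤n+m _ (f 0))

sum-concat : ∀ m n (f : ℕ → ℕ) →
  ∑[ i < m + n ] f (toℕ i) ≡ ∑[ i < m ] f (toℕ i) + ∑[ j < n ] f (m + toℕ j)
sum-concat zero    n f = refl
sum-concat (suc m) n f = trans (cong (_+_ (f 0)) (sum-concat m n (f ∘ suc))) (sym (+-assoc (f 0) _ _))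

sum-by-residue : ∀ N K (f : ℕ → ℕ) →
  ∑[ y < K * N ] f (toℕ y) ≡ ∑[ k < K ] ∑[ r < N ] f (toℕ r + toℕ k * N)
sum-by-residue N zero    f = refl
sum-by-residue N (suc K) f = begin
  ∑[ y < N + K * N ] f (toℕ y)
    ≡⟨ sum-concat N (K * N) f ⟩
  ∑[ r < N ] f (toℕ r) + ∑[ y < K * N ] f (N + toℕ y)
    ≡⟨ cong₂ _+_ (sum-cong-≗ λ r → cong f (sym (+-identityʳ (toℕ {N} r))))
         (trans (sum-by-residue N K (f ∘ _+_ N))
           (sum-cong-≗ λ k → sum-cong-≗ λ r → cong f (shift N (toℕ {N} r) (toℕ {K} k * N)))) ⟩
  ∑[ r < N ] f (toℕ r + 0) + ∑[ k < K ] ∑[ r < N ] f (toℕ r + (N + toℕ k * N)) ∎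
  where
  open ≡-Reasoning
  shift : ∀ N r t → N + (r + t) ≡ r + (N + t)
  shift = solve-∀

-- `L ∸ toℕ y` is the number of lattice points of the big triangle on row `y`. Truncation makes the
-- rows from `L` on contribute zero, so `Y` may later be rounded up to a multiple of `N`.
triangle-number : ∀ L Y → L ≤ Y → L * L + L ≤ 2 * (∑[ y < Y ] (L ∸ toℕ y))
triangle-number zero    Y       z≤n       = z≤n
triangle-number (suc L) (suc Y) (s≤s L≤Y) = begin
  suc L * suc L + suc L              ≡⟨ step L ⟩
  2 * suc L + (L * L + L)            ≤⟨ +-monoʳ-≤ (2 * suc L) (triangle-number L Y L≤Y) ⟩
  2 * suc L + 2 * (∑[ y < Y ] (L ∸ toℕ y))
    ≡⟨ *-distribˡ-+ 2 (suc L) _ ⟨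
  2 * (suc L + ∑[ y < Y ] (L ∸ toℕ y)) ∎
  where
  open ≤-Reasoning
  step : ∀ L → suc L * suc L + suc L ≡ 2 * suc L + (L * L + L)
  step = solve-∀

-- Counting by injections between disjoint unions.

ΣFin→Fin : ∀ {m} (b : Fin m → ℕ) → Σ (Fin m) (Fin ∘ b) → Fin (sum b)
ΣFin→Fin b (zero  , j) = j ↑ˡ _
ΣFin→Fin b (suc i , j) = b zero ↑ʳ ΣFin→Fin (b ∘ suc) (i , j)

Fin→ΣFin : ∀ {m} (b : Fin m → ℕ) → Fin (sum b) → Σ (Fin m) (Fin ∘ b)
Fin→ΣFin {suc m} b x with splitAt (b zero) x
... | inj₁ j = zero , j
... | inj₂ y with Fin→ΣFin (b ∘ suc) y
...   | i , j = suc i , j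

ΣFin→Fin→ΣFin : ∀ {m} (b : Fin m → ℕ) (s : Σ (Fin m) (Fin ∘ b)) → Fin→ΣFin b (ΣFin→Fin b s) ≡ s
ΣFin→Fin→ΣFin {suc m} b (zero  , j) rewrite splitAt-↑ˡ (b zero) j (sum (b ∘ suc)) = refl
ΣFin→Fin→ΣFin {suc m} b (suc i , j)
  rewrite splitAt-↑ʳ (b zero) (sum (b ∘ suc)) (ΣFin→Fin (b ∘ suc) (i , j))
        | ΣFin→Fin→ΣFin (b ∘ suc) (i , j) = refl

Fin→ΣFin→Fin : ∀ {m} (b : Fin m → ℕ) (x : Fin (sum b)) → ΣFin→Fin b (Fin→ΣFin b x) ≡ x
Fin→ΣFin→Fin {suc m} b x with splitAt (b zero) x in eq
... | inj₁ j = splitAt⁻¹-↑ˡ eq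
... | inj₂ y = trans (cong (b zero ↑ʳ_) (Fin→ΣFin→Fin (b ∘ suc) y)) (splitAt⁻¹-↑ʳ eq)

-- Both disjoint unions are in bijection with `Fin` of their total size, so `f` becomes an injection
-- between two such sets.
ΣFin-injective⇒≤ : ∀ {m n} (a : Fin m → ℕ) (b : Fin n → ℕ) (f : Σ (Fin m) (Fin ∘ a) → Σ (Fin n) (Fin ∘ b)) →
  Injective _≡_ _≡_ f → sum a ≤ sum b
ΣFin-injective⇒≤ a b f f-inj = injective⇒≤ {f = ΣFin→Fin b ∘ f ∘ Fin→ΣFin a} λ {x} {y} eq →
  trans (sym (Fin→ΣFin→Fin a x)) (trans (cong (ΣFin→Fin a) (f-inj
    (trans (sym (ΣFin→Fin→ΣFin b _)) (trans (cong (Fin→ΣFin b) eq) (ΣFin→Fin→ΣFin b _)))))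
    (Fin→ΣFin→Fin a y))

-- Sums of distinct natural numbers.

large-value : ∀ {k} (f : Fin (suc k) → ℕ) → Injective _≡_ _≡_ f → ∃ λ i → k ≤ f i
large-value {k} f f-inj with any? (λ i → k ≤? f i)
... | yes large = large
... | no  ¬large = contradiction (λ {i} {j} → inj′ {i} {j}) (<⇒notInjective {f = λ i → fromℕ< (small i)} (n<1+n k))
  where
  small : ∀ i → f i < k
  small i = ≰⇒> λ k≤fi → ¬large (i , k≤fi)
  inj′ : Injective _≡_ _≡_ (λ i → fromℕ< (small i))
  inj′ {i} {j} eq = f-inj (trans (sym (toℕ-fromℕ< (small i))) (trans (cong toℕ eq) (toℕ-fromℕ< (small j))))

-- Among `suc k` distinct values one is at least `k`; removing it leaves `k` distinct values. The
-- resulting bound is 0 + 1 + ... + (k - 1), doubled and written without subtraction.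
distinct-sum : ∀ k (f : Fin k → ℕ) → Injective _≡_ _≡_ f → k * k ≤ 2 * sum f + k
distinct-sum zero    f f-inj = z≤n
distinct-sum (suc k) f f-inj = begin
  suc k * suc k                         ≡⟨ step k ⟩
  2 * k + k * k + 1                     ≤⟨ +-monoˡ-≤ 1 (+-mono-≤ (*-monoʳ-≤ 2 (proj₂ big))
                                             (distinct-sum k rest λ eq → punchIn-injective i _ _ (f-inj eq))) ⟩
  2 * f i + (2 * sum rest + k) + 1      ≡⟨ step′ (f i) (sum rest) k ⟩
  2 * (f i + sum rest) + suc k          ≡⟨ cong (λ t → 2 * t + suc k) (sum-remove {i = i} f) ⟨
  2 * sum f + suc k                     ∎
  where
  open ≤-Reasoning
  big = large-value f f-inj
  i = proj₁ big
  rest : Fin k → ℕ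
  rest = f ∘ punchIn i
  step : ∀ k → suc k * suc k ≡ 2 * k + k * k + 1
  step = solve-∀
  step′ : ∀ a b k → 2 * a + (2 * b + k) + 1 ≡ 2 * (a + b) + suc k
  step′ = solve-∀

halve : ∀ {o p x} t → o ≡ 1ℤ ℤ.+ + 2 ℤ.* t → + 2 ℤ.* p ∣ o ℤ.* x →
  ∃ λ y → x ≡ + 2 ℤ.* y × p ∣ o ℤ.* y
halve {o} {p} {x} t refl 2p∣ox with even
  where
  expand : ∀ t x → (1ℤ ℤ.+ + 2 ℤ.* t) ℤ.* x ≡ + 2 ℤ.* (t ℤ.* x) ℤ.+ x
  expand = ℤ-Solver.solve-∀
  even : + 2 ∣ x
  even = ∣m+n∣m⇒∣n (subst (+ 2 ∣_) (expand t x) (∣-trans (divides p (ℤ.*-comm (+ 2) p)) 2p∣ox))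
                   (divides (t ℤ.* x) (ℤ.*-comm (+ 2) (t ℤ.* x)))
... | divides y refl = y , ℤ.*-comm y (+ 2) ,
  *-cancelˡ-∣ (+ 2) (subst (+ 2 ℤ.* p ∣_) (swap o y) 2p∣ox)
  where
  swap : ∀ o y → o ℤ.* (y ℤ.* + 2) ≡ + 2 ℤ.* (o ℤ.* y)
  swap = ℤ-Solver.solve-∀

-- This is why `N` is a power of 2: the slope of h is only known to be odd, and it has to be
-- cancelled modulo `N`.
2^e∣odd*x⇒2^e∣x : ∀ e {o} t x → o ≡ 1ℤ ℤ.+ + 2 ℤ.* t → + (2 ^ e) ∣ o ℤ.* x → + (2 ^ e) ∣ x
2^e∣odd*x⇒2^e∣x zero    t x _ _ = divides x (sym (ℤ.*-identityʳ x))
2^e∣odd*x⇒2^e∣x (suc e) t x o-odd 2^e∣ox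
  with y , x≡2y , 2^e∣oy ← halve t o-odd (subst (_∣ _) (ℤ.pos-* 2 (2 ^ e)) 2^e∣ox)
  = subst₂ _∣_ (sym (ℤ.pos-* 2 (2 ^ e))) (sym x≡2y) (*-monoʳ-∣ (+ 2) (2^e∣odd*x⇒2^e∣x e t y o-odd 2^e∣oy))

∣m∸n⇒m≤n : ∀ {N m n} → m < N → N ℕ∣ m ∸ n → m ≤ n
∣m∸n⇒m≤n {N} {m} {n} m<N N∣m∸n with m ∸ n in eq
... | zero  = m∸n≡0⇒m≤n eq
... | suc d = contradiction N∣m∸n (>⇒∤ (≤-<-trans (≤-reflexive (sym eq)) (≤-<-trans (m∸n≤m m n) m<N)))

∣m-n⇒m≡n : ∀ {N m n} → m < N → n < N → + N ∣ + m ℤ.- + n → m ≡ n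
∣m-n⇒m≡n {N} {m} {n} m<N n<N N∣m-n = ≤-antisym
  (∣m∸n⇒m≤n m<N (N∣∸ m n N∣m-n))
  (∣m∸n⇒m≤n n<N (N∣∸ n m (subst (+ N ∣_) (negate (+ m) (+ n)) (∣m⇒∣-m N∣m-n))))
  where
  negate : ∀ x y → ℤ.- (x ℤ.- y) ≡ y ℤ.- x
  negate = ℤ-Solver.solve-∀
  N∣∸ : ∀ m n → + N ∣ + m ℤ.- + n → N ℕ∣ m ∸ n
  N∣∸ m n N∣m-n with ≤-total m n
  ... | inj₁ m≤n = subst (N ℕ∣_) (sym (m≤n⇒m∸n≡0 m≤n)) (N ∣0)
  ... | inj₂ n≤m = subst (N ℕ∣_) (cong ∣_∣ (trans (ℤ.m-n≡m⊖n m n) (ℤ.⊖-≥ n≤m))) (∣⇒∣ᵤ N∣m-n)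

∣a-a%ℕN : ∀ a N .{{_ : NonZero N}} → + N ∣ a ℤ.- + (a %ℕ N)
∣a-a%ℕN a N = divides (a /ℕ N) (trans (cong (ℤ._- + (a %ℕ N)) (a≡a%ℕn+[a/ℕn]*n a N)) (cancel (+ (a %ℕ N)) _))
  where
  cancel : ∀ v w → v ℤ.+ w ℤ.- v ≡ w
  cancel = ℤ-Solver.solve-∀

%ℕ-unique : ∀ a {N j} .{{_ : NonZero N}} → j < N → + N ∣ a ℤ.- + j → a %ℕ N ≡ j
%ℕ-unique a {N} {j} j<N N∣a-j = ∣m-n⇒m≡n (n%ℕd<d a N) j<N
  (subst (+ N ∣_) (cancel a (+ (a %ℕ N)) (+ j)) (∣m∣n⇒∣m-n N∣a-j (∣a-a%ℕN a N)))
  where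
  cancel : ∀ a v j → (a ℤ.- j) ℤ.- (a ℤ.- v) ≡ v ℤ.- j
  cancel = ℤ-Solver.solve-∀

-- Lattice triangles and their rows.

-- Lattice coordinates (x , y) are taken along two sides of the big triangle, which is
-- x + y < L with x , y ≥ 0, so a triangle of L lattice points per side.
data Tri : Set where
  up down : (p q : ℕ) → Tri

-- In both cases the offsets i, j ≥ 0 from the corner `(p , q)` satisfy i + j < `N`; `down` is the
-- reflection of `up` in the corner.
Contains : ℕ → Tri → ℕ → ℕ → Set
Contains N (up p q)   x y = p ≤ x × q ≤ y × x + y < p + q + N
Contains N (down p q) x y = x ≤ p × y ≤ q × p + q < x + y + N

-- Measured from the longest row q, towards the apex.
height : Tri → ℤ → ℤ
height (up _ q)   r = r ℤ.- + q
height (down _ q) r = + q ℤ.- r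

-- Exactly one of the rows congruent to r modulo N has its height in [0 , N): depth is this
-- height, and N ∸ depth is the number of lattice points of the triangle on that row.
depth : (N : ℕ) .{{_ : NonZero N}} → Tri → ℕ → ℕ
depth N t r = height t (+ r) %ℕ N

point : Tri → (v z : ℕ) → ℕ × ℕ
point (up p q)   v z = p + z , q + v
point (down p q) v z = p ∸ z , q ∸ v

∸-pos : ∀ {m n} → n ≤ m → + (m ∸ n) ≡ + m ℤ.- + n
∸-pos {m} {n} n≤m = sym (trans (ℤ.m-n≡m⊖n m n) (ℤ.⊖-≥ n≤m))

+-*-pos : ∀ r k N → + (r + k * N) ≡ + r ℤ.+ + k ℤ.* + N
+-*-pos r k N = trans (ℤ.pos-+ r (k * N)) (cong (ℤ._+_ (+ r)) (ℤ.pos-* k N))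

up-height-congruent : ∀ {N y j} r q k → y ≡ r ℤ.+ k ℤ.* N → j ≡ y ℤ.- q → N ∣ (r ℤ.- q) ℤ.- j
up-height-congruent {N} r q k refl refl = divides (ℤ.- k) (ring r q k N)
  where
  ring : ∀ r q k N → (r ℤ.- q) ℤ.- (r ℤ.+ k ℤ.* N ℤ.- q) ≡ ℤ.- k ℤ.* N
  ring = ℤ-Solver.solve-∀

down-height-congruent : ∀ {N y j} r q k → y ≡ r ℤ.+ k ℤ.* N → j ≡ q ℤ.- y → N ∣ (q ℤ.- r) ℤ.- j
down-height-congruent {N} r q k refl refl = divides k (ring r q k N)
  where
  ring : ∀ r q k N → (q ℤ.- r) ℤ.- (q ℤ.- (r ℤ.+ k ℤ.* N)) ≡ k ℤ.* N
  ring = ℤ-Solver.solve-∀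

-- The height `j` of the row lies in [0 , N) and is congruent to `height t (+ r)`, so it is the
-- depth. Hence the row is fixed by `t` and `r` alone, and the offset `z` suffices to recover the
-- point.
locate : ∀ N .{{_ : NonZero N}} t {x r} k → Contains N t x (r + k * N) →
  ∃ λ z → z < N ∸ depth N t r × point t (depth N t r) z ≡ (x , r + k * N)
locate N (up p q) {x} {r} k (p≤x , q≤y , x+y<) = x ∸ p , z< , cong₂ _,_ (m+[n∸m]≡n p≤x) q+v≡y
  where
  y = r + k * N
  j = y ∸ q
  x+j< : x + j < p + N
  x+j< = +-cancelˡ-< q _ _ (subst₂ _<_ (trans (cong (_+_ x) (sym (m+[n∸m]≡n q≤y))) (swap x q j)) (swap′ p q N) x+y<)
    where
    swap : ∀ x q j → x + (q + j) ≡ q + (x + j)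
    swap = solve-∀
    swap′ : ∀ p q N → p + q + N ≡ q + (p + N)
    swap′ = solve-∀
  z+j< : x ∸ p + j < N
  z+j< = +-cancelˡ-< p _ _ (subst (_< p + N) (trans (cong (_+ j) (sym (m+[n∸m]≡n p≤x))) (+-assoc p _ j)) x+j<)
  v≡j : depth N (up p q) r ≡ j
  v≡j = %ℕ-unique (+ r ℤ.- + q) (≤-<-trans (m≤n+m j _) z+j<)
    (up-height-congruent (+ r) (+ q) (+ k) (+-*-pos r k N) (∸-pos q≤y))
  z< = m+n≤o⇒m≤o∸n (suc (x ∸ p)) (subst (λ v → x ∸ p + v < N) (sym v≡j) z+j<)
  q+v≡y = trans (cong (_+_ q) v≡j) (m+[n∸m]≡n q≤y)
locate N (down p q) {x} {r} k (x≤p , y≤q , p+q<) = p ∸ x , z< , cong₂ _,_ (m∸[m∸n]≡n x≤p) q∸v≡y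
  where
  y = r + k * N
  j = q ∸ y
  p+j< : p + j < x + N
  p+j< = +-cancelˡ-< y _ _ (subst₂ _<_ (trans (cong (_+_ p) (sym (m+[n∸m]≡n y≤q))) (swap p y j)) (swap′ x y N) p+q<)
    where
    swap : ∀ x q j → x + (q + j) ≡ q + (x + j)
    swap = solve-∀
    swap′ : ∀ p q N → p + q + N ≡ q + (p + N)
    swap′ = solve-∀
  z+j< : p ∸ x + j < N
  z+j< = +-cancelˡ-< x _ _ (subst (_< x + N) (trans (cong (_+ j) (sym (m+[n∸m]≡n x≤p))) (+-assoc x _ j)) p+j<)
  v≡j : depth N (down p q) r ≡ j
  v≡j = %ℕ-unique (+ q ℤ.- + r) (≤-<-trans (m≤n+m j _) z+j<)
    (down-height-congruent (+ r) (+ q) (+ k) (+-*-pos r k N) (∸-pos y≤q))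
  z< = m+n≤o⇒m≤o∸n (suc (p ∸ x)) (subst (λ v → p ∸ x + v < N) (sym v≡j) z+j<)
  q∸v≡y = trans (cong (q ∸_) v≡j) (m∸[m∸n]≡n y≤q)

-- Counting a lattice cover on the rows of one residue.

Covers : ∀ {m} → ℕ → (Fin m → Tri) → ℕ → Set
Covers N t L = ∀ x y → x + y < L → ∃ λ i → Contains N (t i) x y

-- Truncated subtraction makes the rows above the apex of the big triangle empty.
rows : (L N n r : ℕ) → ℕ
rows L N n r = ∑[ k < suc n ] (L ∸ (r + toℕ k * N))

-- Send each lattice point of the big triangle on these rows to a small triangle containing it and
-- to its offset there. `recover` reads the point back from this pair, so the map is injective.
rows≤depths : ∀ {m} L N .{{_ : NonZero N}} n {t : Fin m → Tri} → Covers N t L → ∀ r →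
  rows L N n r ≤ ∑[ i < m ] (N ∸ depth N (t i) r)
rows≤depths {m} L N n {t} covers r = ΣFin-injective⇒≤ a b f f-injective
  where
  a : Fin (suc n) → ℕ
  a k = L ∸ (r + toℕ k * N)
  b : Fin m → ℕ
  b i = N ∸ depth N (t i) r
  inside : ∀ s → toℕ (proj₂ s) + (r + toℕ (proj₁ s) * N) < L
  inside (k , x) = m≤n∸o⇒m+o≤n (toℕ<n x)
    where
    m≤n∸o⇒m+o≤n : ∀ {m n o} → suc m ≤ n ∸ o → suc m + o ≤ n
    m≤n∸o⇒m+o≤n {m} {n} {o} m<n∸o = m≤n∸o (<⇒≤ (m∸n≢0⇒n<m λ n∸o≡0 → n≮0 (subst (m <_) n∸o≡0 m<n∸o)))
      where
      m≤n∸o : o ≤ n → suc m + o ≤ n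
      m≤n∸o o≤n = ≤-trans (+-monoˡ-≤ o m<n∸o) (≤-reflexive (m∸n+n≡m o≤n))
  tri : Σ (Fin (suc n)) (Fin ∘ a) → Fin m
  tri s = proj₁ (covers _ _ (inside s))
  place : ∀ s → ∃ λ z → z < b (tri s) × point (t (tri s)) (depth N (t (tri s)) r) z ≡ (toℕ (proj₂ s) , r + toℕ (proj₁ s) * N)
  place s = locate N (t (tri s)) (toℕ (proj₁ s)) (proj₂ (covers _ _ (inside s)))
  f : Σ (Fin (suc n)) (Fin ∘ a) → Σ (Fin m) (Fin ∘ b)
  f s = tri s , fromℕ< (proj₁ (proj₂ (place s)))
  recover : Σ (Fin m) (Fin ∘ b) → ℕ × ℕ
  recover (i , z) = point (t i) (depth N (t i) r) (toℕ z)
  recover-f : ∀ s → recover (f s) ≡ (toℕ (proj₂ s) , r + toℕ (proj₁ s) * N)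
  recover-f s = trans (cong (point (t (tri s)) _) (toℕ-fromℕ< (proj₁ (proj₂ (place s))))) (proj₂ (proj₂ (place s)))
  same : ∀ {k k′} {x : Fin (a k)} {x′ : Fin (a k′)} → k ≡ k′ → toℕ x ≡ toℕ x′ → (k , x) ≡ (k′ , x′)
  same refl x≡x′ = cong (_ ,_) (toℕ-injective x≡x′)
  f-injective : Injective _≡_ _≡_ f
  f-injective {s} {s′} eq with ,-injective (trans (sym (recover-f s)) (trans (cong recover eq) (recover-f s′)))
  ... | x≡x′ , y≡y′ = same (toℕ-injective (*-cancelʳ-≡ _ _ N (+-cancelˡ-≡ r _ _ y≡y′))) x≡x′

-- For such `r` the term k = `n` is `E ∸ r`, which is zero, and none of the other `n` terms is
-- truncated, so each drops by one when `r` grows by one. Both sides equal `total n`.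
rows-linear : ∀ N E n {r r′} → E ≤ r → r ≤ N → E ≤ r′ → r′ ≤ N →
  rows (n * N + E) N n r + n * r ≡ rows (n * N + E) N n r′ + n * r′
rows-linear N E n E≤r r≤N E≤r′ r′≤N = trans (linear n E≤r r≤N) (sym (linear n E≤r′ r′≤N))
  where
  total : ℕ → ℕ
  total zero    = 0
  total (suc n) = suc n * N + E + total n
  regroup : ∀ a b r n → a + b + (r + n * r) ≡ (a + r) + (b + n * r)
  regroup = solve-∀
  linear : ∀ n {r} → E ≤ r → r ≤ N → rows (n * N + E) N n r + n * r ≡ total n
  linear zero    {r} E≤r r≤N rewrite +-identityʳ r | m≤n⇒m∸n≡0 E≤r = refl
  linear (suc n) {r} E≤r r≤N = begin
    (L ∸ (r + 0)) + ∑[ k < suc n ] (L ∸ (r + (N + toℕ k * N))) + (r + n * r)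
      ≡⟨ cong₂ (λ a b → a + b + (r + n * r)) (cong (L ∸_) (+-identityʳ r)) (sum-cong-≗ {suc n} λ k → shift (toℕ k)) ⟩
    (L ∸ r) + rows (n * N + E) N n r + (r + n * r)
      ≡⟨ regroup (L ∸ r) (rows (n * N + E) N n r) r n ⟩
    (L ∸ r + r) + (rows (n * N + E) N n r + n * r)
      ≡⟨ cong₂ _+_ (m∸n+n≡m r≤L) (linear n E≤r r≤N) ⟩
    L + total n ∎
    where
    open ≡-Reasoning
    L = suc n * N + E
    r≤L : r ≤ L
    r≤L = ≤-trans r≤N (≤-trans (m≤m+n N (n * N)) (m≤m+n _ E))
    -- Without its first `N` rows, the big triangle becomes the one for the preceding `n`.
    shift : ∀ k → L ∸ (r + (N + k * N)) ≡ (n * N + E) ∸ (r + k * N)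
    shift k = trans (cong₂ _∸_ (+-assoc N (n * N) E) (swap r N (k * N))) ([m+n]∸[m+o]≡n∸o N (n * N + E) (r + k * N))
      where
      swap : ∀ r N t → r + (N + t) ≡ N + (r + t)
      swap = solve-∀

-- Orientations, parity and the slope of the depths modulo `N`.

sign : Tri → ℤ
sign (up _ _)   = 1ℤ
sign (down _ _) = -1ℤ

signs : ∀ {m} → (Fin m → Tri) → ℤ
signs {zero}  t = 0ℤ
signs {suc m} t = sign (t zero) ℤ.+ signs (t ∘ suc)

-- The witness `u` is the number of `down` triangles: each turns a summand 1 into -1.
signs-parity : ∀ {m} (t : Fin m → Tri) → ∃ λ u → signs t ≡ + m ℤ.- + 2 ℤ.* u
signs-parity {zero}  t = 0ℤ , refl
signs-parity {suc m} t with t zero | signs-parity (t ∘ suc)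
... | up _ _   | u , eq = u , trans (cong (ℤ._+_ 1ℤ) eq) (ring (+ m) u)
  where
  ring : ∀ m u → 1ℤ ℤ.+ (m ℤ.- + 2 ℤ.* u) ≡ (1ℤ ℤ.+ m) ℤ.- + 2 ℤ.* u
  ring = ℤ-Solver.solve-∀
... | down _ _ | u , eq = 1ℤ ℤ.+ u , trans (cong (ℤ._+_ -1ℤ) eq) (ring (+ m) u)
  where
  ring : ∀ m u → -1ℤ ℤ.+ (m ℤ.- + 2 ℤ.* u) ≡ (1ℤ ℤ.+ m) ℤ.- + 2 ℤ.* (1ℤ ℤ.+ u)
  ring = ℤ-Solver.solve-∀

n²≡n+2T : ∀ n → ∃ λ T → n * n ≡ n + 2 * T
n²≡n+2T zero = 0 , refl
n²≡n+2T (suc n) with n²≡n+2T n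
... | T , eq = n + T , trans (expand n) (trans (cong (λ s → suc (n + n + s)) eq) (collect n T))
  where
  expand : ∀ n → suc n * suc n ≡ suc (n + n + n * n)
  expand = solve-∀
  collect : ∀ n T → suc (n + n + (n + 2 * T)) ≡ suc n + 2 * (n + T)
  collect = solve-∀

-- Modulo 2, `signs t` is the number of triangles, and n - (n² + 1) is odd because n² - n is even.
n-signs-odd : ∀ n (t : Fin (n * n + 1) → Tri) → ∃ λ u → + n ℤ.- signs t ≡ 1ℤ ℤ.+ + 2 ℤ.* u
n-signs-odd n t with signs-parity t | n²≡n+2T n
... | u , eq | T , n²≡ = u ℤ.- 1ℤ ℤ.- + T ,
  trans (cong (λ s → + n ℤ.- s) (trans eq (cong (ℤ._- (+ 2 ℤ.* u)) m≡))) (ring (+ n) (+ T) u)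
  where
  m≡ : + (n * n + 1) ≡ (+ n ℤ.+ + 2 ℤ.* + T) ℤ.+ 1ℤ
  m≡ = trans (ℤ.pos-+ (n * n) 1) (cong (ℤ._+ 1ℤ) (trans (cong +_ n²≡)
         (trans (ℤ.pos-+ n (2 * T)) (cong (ℤ._+_ (+ n)) (ℤ.pos-* 2 T)))))
  ring : ∀ n T u → n ℤ.- (((n ℤ.+ + 2 ℤ.* T) ℤ.+ 1ℤ) ℤ.- + 2 ℤ.* u) ≡ 1ℤ ℤ.+ + 2 ℤ.* (u ℤ.- 1ℤ ℤ.- T)
  ring = ℤ-Solver.solve-∀

height-difference : ∀ t r r′ → height t r ℤ.- height t r′ ≡ sign t ℤ.* (r ℤ.- r′)
height-difference (up p q) r r′ = ring r r′ (+ q)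
  where
  ring : ∀ r r′ q → (r ℤ.- q) ℤ.- (r′ ℤ.- q) ≡ 1ℤ ℤ.* (r ℤ.- r′)
  ring = ℤ-Solver.solve-∀
height-difference (down p q) r r′ = ring r r′ (+ q)
  where
  ring : ∀ r r′ q → (q ℤ.- r) ℤ.- (q ℤ.- r′) ≡ -1ℤ ℤ.* (r ℤ.- r′)
  ring = ℤ-Solver.solve-∀

-- The height is affine in `r` with slope `sign t`, and the depth is its residue.
depth-difference : ∀ N .{{_ : NonZero N}} t r r′ →
  + N ∣ sign t ℤ.* (+ r ℤ.- + r′) ℤ.- (+ depth N t r ℤ.- + depth N t r′)
depth-difference N t r r′ = subst (λ a → + N ∣ a ℤ.- (+ depth N t r ℤ.- + depth N t r′)) (height-difference t (+ r) (+ r′))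
  (subst (+ N ∣_) (regroup (height t (+ r)) (height t (+ r′)) (+ depth N t r) (+ depth N t r′))
    (∣m∣n⇒∣m-n (∣a-a%ℕN (height t (+ r)) N) (∣a-a%ℕN (height t (+ r′)) N)))
  where
  regroup : ∀ a a′ v v′ → (a ℤ.- v) ℤ.- (a′ ℤ.- v′) ≡ (a ℤ.- a′) ℤ.- (v ℤ.- v′)
  regroup = ℤ-Solver.solve-∀

depths : ∀ {m} → (N : ℕ) .{{_ : NonZero N}} → (Fin m → Tri) → ℕ → ℕ
depths {m} N t r = ∑[ i < m ] depth N (t i) r

depths-difference : ∀ {m} N .{{_ : NonZero N}} (t : Fin m → Tri) r r′ →
  + N ∣ signs t ℤ.* (+ r ℤ.- + r′) ℤ.- (+ depths N t r ℤ.- + depths N t r′)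
depths-difference {zero}  N t r r′ = divides 0ℤ refl
depths-difference {suc m} N t r r′ = subst (+ N ∣_)
  (trans (regroup (sign (t zero)) (signs (t ∘ suc)) (+ r ℤ.- + r′) (+ d) (+ d′) (+ D) (+ D′))
    (cong₂ (λ a a′ → signs t ℤ.* (+ r ℤ.- + r′) ℤ.- (a ℤ.- a′)) (sym (ℤ.pos-+ d D)) (sym (ℤ.pos-+ d′ D′))))
  (∣m∣n⇒∣m+n (depth-difference N (t zero) r r′) (depths-difference N (t ∘ suc) r r′))
  where
  d = depth N (t zero) r
  d′ = depth N (t zero) r′
  D = depths N (t ∘ suc) r
  D′ = depths N (t ∘ suc) r′
  regroup : ∀ s S x d d′ D D′ → (s ℤ.* x ℤ.- (d ℤ.- d′)) ℤ.+ (S ℤ.* x ℤ.- (D ℤ.- D′))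
    ≡ (s ℤ.+ S) ℤ.* x ℤ.- ((d ℤ.+ D) ℤ.- (d′ ℤ.+ D′))
  regroup = ℤ-Solver.solve-∀

-- The counting contradiction for lattice covers.

-- Here `H`, `R` and `V` stand for the sums over all residues of h, of the lattice points of T and
-- of the depths. Adding the three lower bounds and cancelling m N² leaves F² + L² + L ≤ m N² + F +
-- m N. As F² + L² = m N² + 2 (n - 1) N E + 2 E², this contradicts the first hypothesis. Using `k`
-- for n - 1 and `E + F` for `N` avoids subtraction.
count-contradiction : ∀ k E F H R V → let n = suc k; N = E + F; L = n * N + E; m = n * n + 1 in
  (n * n + 2) * N < 2 * (E * E) →
  H + R + V ≡ N * (m * N) → F * F ≤ 2 * H + F → L * L + L ≤ 2 * R → ¬ m * (N * N) ≤ 2 * V + m * N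
count-contradiction k E F H R V large total H≥ R≥ V≥ = <-irrefl refl (begin-strict
  common + (n * n + 2) * N                         <⟨ +-monoʳ-< common large ⟩
  common + 2 * (E * E)                             ≤⟨ m≤m+n _ _ ⟩
  common + 2 * (E * E) + (2 * (k * (N * E)) + n * N + E)
                                                   ≡⟨ lower k E F ⟨
  F * F + (L * L + L)                              ≤⟨ +-cancelʳ-≤ (m * (N * N)) _ _ combined ⟩
  m * (N * N) + F + m * N                          ≤⟨ m≤m+n _ E ⟩
  m * (N * N) + F + m * N + E                      ≡⟨ upper n E F ⟩
  common + (n * n + 2) * N                         ∎)
  where
  open ≤-Reasoning
  n = suc k
  N = E + F
  L = n * N + E
  m = n * n + 1
  -- This is `m * (N * N)` with one of the squares `N * N` multiplied out.
  common = n * n * (N * N) + E * E + 2 * (E * F) + F * F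
  lower : ∀ k E F → F * F + ((suc k * (E + F) + E) * (suc k * (E + F) + E) + (suc k * (E + F) + E))
    ≡ suc k * suc k * ((E + F) * (E + F)) + E * E + 2 * (E * F) + F * F + 2 * (E * E)
      + (2 * (k * ((E + F) * E)) + suc k * (E + F) + E)
  lower = solve-∀
  upper : ∀ n E F → (n * n + 1) * ((E + F) * (E + F)) + F + (n * n + 1) * (E + F) + E
    ≡ n * n * ((E + F) * (E + F)) + E * E + 2 * (E * F) + F * F + (n * n + 2) * (E + F)
  upper = solve-∀
  regroup : ∀ H R V F M → 2 * H + F + 2 * R + (2 * V + M) ≡ 2 * (H + R + V) + F + M
  regroup = solve-∀
  double : ∀ N m F → 2 * (N * (m * N)) + F + m * N ≡ m * (N * N) + F + m * N + m * (N * N)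
  double = solve-∀
  combined : F * F + (L * L + L) + m * (N * N) ≤ m * (N * N) + F + m * N + m * (N * N)
  combined = begin
    F * F + (L * L + L) + m * (N * N)      ≤⟨ +-mono-≤ (+-mono-≤ H≥ R≥) V≥ ⟩
    2 * H + F + 2 * R + (2 * V + m * N)    ≡⟨ regroup H R V F (m * N) ⟩
    2 * (H + R + V) + F + m * N            ≡⟨ cong (λ s → 2 * s + F + m * N) total ⟩
    2 * (N * (m * N)) + F + m * N          ≡⟨ double N m F ⟩
    m * (N * N) + F + m * N + m * (N * N)  ∎

-- With slope ±1 modulo `N`, the depths at the `N` residues are distinct.
depth-sum : ∀ N .{{_ : NonZero N}} t → N * N ≤ 2 * (∑[ r < N ] depth N t (toℕ r)) + N
depth-sum N t = distinct-sum N (depth N t ∘ toℕ) λ {r} {r′} → inj r r′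
  where
  inj : ∀ r r′ → depth N t (toℕ r) ≡ depth N t (toℕ r′) → r ≡ r′
  inj r r′ eq = toℕ-injective (∣m-n⇒m≡n (toℕ<n r) (toℕ<n r′) (unsign t N∣±))
    where
    cancel : ∀ a d → a ℤ.- (d ℤ.- d) ≡ a
    cancel = ℤ-Solver.solve-∀
    x = sign t ℤ.* (+ toℕ r ℤ.- + toℕ r′)
    N∣± : + N ∣ x
    N∣± = subst (+ N ∣_) (trans (cong (λ d → x ℤ.- (+ depth N t (toℕ r) ℤ.- + d)) (sym eq)) (cancel x (+ depth N t (toℕ r))))
            (depth-difference N t (toℕ r) (toℕ r′))
    unsign : ∀ t {x} → + N ∣ sign t ℤ.* x → + N ∣ x
    unsign (up _ _)   {x} = subst (+ N ∣_) (ℤ.*-identityˡ x)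
    unsign (down _ _) {x} N∣-x = subst (+ N ∣_) (trans (cong ℤ.-_ (ℤ.-1*i≡-i x)) (ℤ.neg-involutive x)) (∣m⇒∣-m N∣-x)

no-lattice-cover : ∀ e k E F {t : Fin (suc k * suc k + 1) → Tri} → let n = suc k in
  E + F ≡ 2 ^ e → (n * n + 2) * (E + F) < 2 * (E * E) → ¬ Covers (E + F) t (n * (E + F) + E)
no-lattice-cover e k E F {t} N≡2^e large covers =
  count-contradiction k E F (∑[ r < N ] h (toℕ r)) (∑[ r < N ] R (toℕ r)) (∑[ r < N ] V (toℕ r))
    large total F≤ rows-total depths-total
  where
  n = suc k
  N = E + F
  L = n * N + E
  m = n * n + 1
  instance
    N≢0 : NonZero N
    N≢0 = subst NonZero (sym N≡2^e) (m^n≢0 2 e)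
  S : ℕ → ℕ
  S r = ∑[ i < m ] (N ∸ depth N (t i) r)
  R : ℕ → ℕ
  R = rows L N n
  V : ℕ → ℕ
  V = depths N t
  h : ℕ → ℕ
  h r = S r ∸ R r
  S+V≡mN : ∀ r → S r + V r ≡ m * N
  S+V≡mN r = trans (sym (∑-distrib-+ (λ i → N ∸ depth N (t i) r) (λ i → depth N (t i) r)))
    (trans (sum-cong-≗ λ i → m∸n+n≡m (<⇒≤ (n%ℕd<d (height (t i) (+ r)) N))) (sum-const m N))
  -- By `rows≤depths` the subtraction in `h` is not truncated, so the sum is the same for every `r`.
  balance : ∀ r → h r + R r + V r ≡ m * N
  balance r = trans (cong (_+ V r) (m∸n+n≡m (rows≤depths L N n covers r))) (S+V≡mN r)
  total : ∑[ r < N ] h (toℕ r) + ∑[ r < N ] R (toℕ r) + ∑[ r < N ] V (toℕ r) ≡ N * (m * N)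
  total = trans (cong (_+ ∑[ r < N ] V (toℕ r)) (sym (∑-distrib-+ {N} (h ∘ toℕ) (R ∘ toℕ))))
    (trans (sym (∑-distrib-+ {N} (λ r → h (toℕ r) + R (toℕ r)) (V ∘ toℕ)))
      (trans (sum-cong-≗ {N} (balance ∘ toℕ)) (sum-const N (m * N))))
  rows-total : L * L + L ≤ 2 * ∑[ r < N ] R (toℕ r)
  rows-total = ≤-trans (triangle-number L (suc n * N) L≤)
    (≤-reflexive (cong (2 *_) (trans (sum-by-residue N (suc n) (L ∸_))
      (∑-comm {suc n} {N} (λ k r → L ∸ (toℕ r + toℕ k * N))))))
    where
    -- Thus `suc n` blocks of `N` rows contain the whole big triangle.
    L≤ : L ≤ suc n * N
    L≤ = ≤-trans (+-monoʳ-≤ (n * N) (m≤m+n E F)) (≤-reflexive (+-comm (n * N) N))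
  depths-total : m * (N * N) ≤ 2 * ∑[ r < N ] V (toℕ r) + m * N
  depths-total = begin
    m * (N * N)                                       ≡⟨ sum-const m (N * N) ⟨
    ∑[ i < m ] (N * N)                                ≤⟨ sum-mono (λ i → depth-sum N (t i)) ⟩
    ∑[ i < m ] (2 * D i + N)                          ≡⟨ ∑-distrib-+ (λ i → 2 * D i) (λ _ → N) ⟩
    ∑[ i < m ] (2 * D i) + ∑[ i < m ] N               ≡⟨ cong₂ _+_ (sym (*-distribˡ-sum 2 D)) (sum-const m N) ⟩
    2 * sum D + m * N                                 ≡⟨ cong (λ s → 2 * s + m * N)
                                                           (∑-comm (λ i r → depth N (t i) (toℕ {N} r))) ⟩
    2 * ∑[ r < N ] V (toℕ r) + m * N                  ∎
    where
    open ≤-Reasoning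
    D : Fin m → ℕ
    D i = ∑[ r < N ] depth N (t i) (toℕ r)
  F≤ : F * F ≤ 2 * ∑[ r < N ] h (toℕ r) + F
  -- Only the `F` residues from `E` to `N - 1` are known to give distinct values; the others
  -- contribute at least zero.
  F≤ = ≤-trans (distinct-sum F (λ j → h (E + toℕ j)) λ {i} {j} eq →
      toℕ-injective (+-cancelˡ-≡ E _ _ (h-distinct (bound i) (bound j) eq)))
    (+-monoˡ-≤ F (*-monoʳ-≤ 2 (sum-tail-≤ E F h)))
    where
    bound : ∀ (j : Fin F) → E ≤ E + toℕ j × E + toℕ j < N
    bound j = m≤m+n E _ , +-monoʳ-< E (toℕ<n j)
    -- If `h r ≡ h r′`, then `balance` and `rows-linear` make V change by exactly n (r - r′), while
    -- modulo `N` it changes by `signs t` times r - r′. So `N` divides the odd number n - `signs t`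
    -- times r - r′, hence r - r′ itself.
    h-distinct : ∀ {r r′} → E ≤ r × r < N → E ≤ r′ × r′ < N → h r ≡ h r′ → r ≡ r′
    h-distinct {r} {r′} (E≤r , r<N) (E≤r′ , r′<N) eq = ∣m-n⇒m≡n r<N r′<N
      (subst (λ N → + N ∣ + r ℤ.- + r′) (sym N≡2^e) (2^e∣odd*x⇒2^e∣x e (proj₁ odd) (+ r ℤ.- + r′) (proj₂ odd)
        (subst (λ N → + N ∣ (+ n ℤ.- signs t) ℤ.* (+ r ℤ.- + r′)) N≡2^e
          (subst (+ N ∣_) slope (∣m⇒∣-m (depths-difference N t r r′))))))
      where
      odd = n-signs-odd n t
      R+V : R r + V r ≡ R r′ + V r′
      R+V = +-cancelˡ-≡ (h r) _ _ (trans (sym (+-assoc (h r) _ _)) (trans (balance r)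
        (sym (trans (cong (_+ (R r′ + V r′)) eq) (trans (sym (+-assoc (h r′) _ _)) (balance r′))))))
      V+nr : V r + n * r′ ≡ V r′ + n * r
      V+nr = +-cancelˡ-≡ (R r + R r′) _ _ (trans (swap (R r) (R r′) (V r) (n * r′))
        (trans (cong₂ _+_ R+V (sym (rows-linear N E n E≤r (<⇒≤ r<N) E≤r′ (<⇒≤ r′<N)))) (swap′ (R r) (R r′) (V r′) (n * r))))
        where
        swap : ∀ a b c d → (a + b) + (c + d) ≡ (a + c) + (b + d)
        swap = solve-∀
        swap′ : ∀ a b c d → (b + c) + (a + d) ≡ (a + b) + (c + d)
        swap′ = solve-∀
      V-V : + V r ℤ.- + V r′ ≡ + n ℤ.* (+ r ℤ.- + r′)
      V-V = difference (+ V r) (+ V r′) (+ n) (+ r) (+ r′)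
        (trans (sym (+-*-pos (V r) n r′)) (trans (cong +_ V+nr) (+-*-pos (V r′) n r)))
        where
        difference : ∀ v v′ n r r′ → v ℤ.+ n ℤ.* r′ ≡ v′ ℤ.+ n ℤ.* r → v ℤ.- v′ ≡ n ℤ.* (r ℤ.- r′)
        difference v v′ n r r′ eq = trans (add v v′ n r′) (trans (cong (λ a → a ℤ.- v′ ℤ.- n ℤ.* r′) eq) (remove v′ n r r′))
          where
          add : ∀ v v′ n r′ → v ℤ.- v′ ≡ v ℤ.+ n ℤ.* r′ ℤ.- v′ ℤ.- n ℤ.* r′
          add = ℤ-Solver.solve-∀
          remove : ∀ v′ n r r′ → v′ ℤ.+ n ℤ.* r ℤ.- v′ ℤ.- n ℤ.* r′ ≡ n ℤ.* (r ℤ.- r′)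
          remove = ℤ-Solver.solve-∀
      slope : ℤ.- (signs t ℤ.* (+ r ℤ.- + r′) ℤ.- (+ V r ℤ.- + V r′)) ≡ (+ n ℤ.- signs t) ℤ.* (+ r ℤ.- + r′)
      slope = trans (cong (λ v → ℤ.- (signs t ℤ.* (+ r ℤ.- + r′) ℤ.- v)) V-V) (factor (signs t) (+ n) (+ r ℤ.- + r′))
        where
        factor : ∀ s n x → ℤ.- (s ℤ.* x ℤ.- n ℤ.* x) ≡ (n ℤ.- s) ℤ.* x
        factor = ℤ-Solver.solve-∀

-- Bounded search and growth of powers of two.

-- Bounded search stands in for rounding a real number up. If no `x < L` satisfies `P`, the number
-- returned is arbitrary and the claim about it is vacuous.
bounded-least : (P : ℕ → Set) → Decidable P → ∀ L → ∃ λ p → ∀ x → x < L → P x → p ≤ x × P p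
bounded-least P P? zero = 0 , λ _ ()
bounded-least P P? (suc L) with P? 0 | bounded-least (P ∘ suc) (P? ∘ suc) L
... | yes P0 | _         = 0 , λ _ _ _ → z≤n , P0
... | no ¬P0 | p , least = suc p , λ where
  zero    _         P0 → contradiction P0 ¬P0
  (suc x) (s≤s x<L) Px → s≤s (proj₁ (least x x<L Px)) , proj₂ (least x x<L Px)

bounded-greatest : (P : ℕ → Set) → Decidable P → ∀ L → ∃ λ p → ∀ x → x < L → P x → x ≤ p × P p
bounded-greatest P P? zero = 0 , λ _ ()
bounded-greatest P P? (suc L) with P? L | bounded-greatest P P? L
... | yes PL | _            = L , λ x x<1+L _ → ≤-pred x<1+L , PL
... | no ¬PL | p , greatest = p , λ x x<1+L Px → greatest x (≤∧≢⇒< (≤-pred x<1+L) λ { refl → ¬PL Px }) Px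

n<2^n : ∀ n → n < 2 ^ n
n<2^n zero    = s≤s z≤n
n<2^n (suc n) = +-mono-≤-< (m^n>0 2 n) (subst (n <_) (sym (+-identityʳ (2 ^ n))) (n<2^n n))

-- Ring structure of the reals and a solver with integer coefficients.

module Field (R : RealField) where
  open RealField R public renaming
    (_+_ to _⊕_; _*_ to _⊗_; -_ to ⊖_; _-_ to infixl 6 _⊝_; _<_ to _≺_; _≤_ to _≼_;
     +-assoc to ⊕-assoc; +-comm to ⊕-comm; *-assoc to ⊗-assoc; *-comm to ⊗-comm;
     +-identityˡ to ⊕-identityˡ; -‿inverseˡ to ⊕-inverseˡ; *-identityˡ to ⊗-identityˡ; distribˡ to ⊗-distribˡ-⊕;
     *-inverse to ⊗-inverse; <-irrefl to ≺-irrefl; <-trans to ≺-trans; <-trichotomy to ≺-trichotomy;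
     +-mono-< to ⊕-monoˡ-≺; *-pos to ⊗-pos)

  commutativeRing : CommutativeRing 0ℓ 0ℓ
  commutativeRing = record
    { Carrier = Carrier ; _≈_ = _≡_ ; _+_ = _⊕_ ; _*_ = _⊗_ ; -_ = ⊖_ ; 0# = 0# ; 1# = 1#
    ; isCommutativeRing = record
      { isRing = record
        { +-isAbelianGroup = record
          { isGroup = record
            { isMonoid = record
              { isSemigroup = record
                { isMagma = record { isEquivalence = isEquivalence ; ∙-cong = cong₂ _⊕_ }
                ; assoc = ⊕-assoc }
              ; identity = comm∧idˡ⇒id ⊕-comm ⊕-identityˡ }
            ; inverse = comm∧invˡ⇒inv ⊕-comm ⊕-inverseˡ
            ; ⁻¹-cong = cong ⊖_ }
          ; comm = ⊕-comm }
        ; *-cong = cong₂ _⊗_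
        ; *-assoc = ⊗-assoc
        ; *-identity = comm∧idˡ⇒id ⊗-comm ⊗-identityˡ
        ; distrib = ⊗-distribˡ-⊕ , comm∧distrˡ⇒distrʳ ⊗-comm ⊗-distribˡ-⊕ }
      ; *-comm = ⊗-comm } }

  open CommutativeRing commutativeRing public using (ring)
    renaming (+-identityʳ to ⊕-identityʳ; zeroˡ to ⊗-zeroˡ; zeroʳ to ⊗-zeroʳ;
      distribʳ to ⊗-distribʳ-⊕; -‿inverseʳ to ⊕-inverseʳ)
  open Algebra.Properties.Ring ring public using (-0#≈0#; -‿involutive; -‿+-comm; -‿distribˡ-*; -‿distribʳ-*)

  fromℕ-+ : ∀ m n → fromℕ (m + n) ≡ fromℕ m ⊕ fromℕ n
  fromℕ-+ zero    n = sym (⊕-identityˡ _)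
  fromℕ-+ (suc m) n = trans (cong (_⊕_ 1#) (fromℕ-+ m n)) (sym (⊕-assoc 1# _ _))

  fromℕ-* : ∀ m n → fromℕ (m * n) ≡ fromℕ m ⊗ fromℕ n
  fromℕ-* zero    n = sym (⊗-zeroˡ _)
  fromℕ-* (suc m) n = trans (fromℕ-+ n (m * n)) (trans (cong₂ _⊕_ (sym (⊗-identityˡ _)) (fromℕ-* m n))
                        (sym (⊗-distribʳ-⊕ (fromℕ n) 1# (fromℕ m))))

  fromℤ : ℤ → Carrier
  fromℤ (+ n)    = fromℕ n
  fromℤ -[1+ n ] = ⊖ fromℕ (suc n)

  fromℤ-neg : ∀ x → fromℤ (ℤ.- x) ≡ ⊖ fromℤ x
  fromℤ-neg (+ zero)  = sym -0#≈0#
  fromℤ-neg (+ suc n) = refl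
  fromℤ-neg -[1+ n ]  = sym (-‿involutive _)

  fromℤ-⊖ : ∀ m n → fromℤ (m ℤ.⊖ n) ≡ fromℕ m ⊝ fromℕ n
  fromℤ-⊖ m       zero    = sym (trans (cong (_⊕_ (fromℕ m)) -0#≈0#) (⊕-identityʳ _))
  fromℤ-⊖ zero    (suc n) = sym (⊕-identityˡ _)
  fromℤ-⊖ (suc m) (suc n) = trans (cong fromℤ (ℤ.[1+m]⊖[1+n]≡m⊖n m n)) (trans (fromℤ-⊖ m n) (sym cancel))
    where
    cancel : (1# ⊕ fromℕ m) ⊝ (1# ⊕ fromℕ n) ≡ fromℕ m ⊝ fromℕ n
    cancel = trans (cong₂ _⊕_ (⊕-comm 1# _) (sym (-‿+-comm 1# _)))
      (trans (⊕-assoc _ 1# _) (cong (_⊕_ (fromℕ m)) (trans (sym (⊕-assoc 1# _ _))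
        (trans (cong (_⊕ (⊖ fromℕ n)) (⊕-inverseʳ 1#)) (⊕-identityˡ _)))))

  fromℤ-+ : ∀ x y → fromℤ (x ℤ.+ y) ≡ fromℤ x ⊕ fromℤ y
  fromℤ-+ (+ m)    (+ n)    = fromℕ-+ m n
  fromℤ-+ (+ m)    -[1+ n ] = fromℤ-⊖ m (suc n)
  fromℤ-+ -[1+ m ] (+ n)    = trans (fromℤ-⊖ n (suc m)) (⊕-comm _ _)
  fromℤ-+ -[1+ m ] -[1+ n ] = trans (cong (⊖_ ∘ fromℕ) (cong suc (sym (+-suc m n))))
    (trans (cong ⊖_ (fromℕ-+ (suc m) (suc n))) (sym (-‿+-comm _ _)))

  fromℤ-* : ∀ x y → fromℤ (x ℤ.* y) ≡ fromℤ x ⊗ fromℤ y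
  fromℤ-* (+ m)    (+ n)    = trans (cong fromℤ (sym (ℤ.pos-* m n))) (fromℕ-* m n)
  fromℤ-* (+ m)    -[1+ n ] = trans (cong fromℤ (ℤ.-◃n≡-n (m * suc n)))
    (trans (fromℤ-neg (+ (m * suc n))) (trans (cong ⊖_ (fromℕ-* m (suc n))) (-‿distribʳ-* _ _)))
  fromℤ-* -[1+ m ] (+ n)    = trans (cong fromℤ (ℤ.-◃n≡-n (suc m * n)))
    (trans (fromℤ-neg (+ (suc m * n))) (trans (cong ⊖_ (fromℕ-* (suc m) n)) (-‿distribˡ-* _ _)))
  fromℤ-* -[1+ m ] -[1+ n ] = trans (fromℕ-* (suc m) (suc n))
    (sym (trans (sym (-‿distribˡ-* _ _)) (trans (cong ⊖_ (sym (-‿distribʳ-* _ _))) (-‿involutive _))))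

  private
    almostCommutativeRing : AlmostCommutativeRing 0ℓ 0ℓ
    almostCommutativeRing = fromCommutativeRing commutativeRing

    ℤ⟶R : ℤ.+-*-rawRing -Raw-AlmostCommutative⟶ almostCommutativeRing
    ℤ⟶R = record { ⟦_⟧ = fromℤ ; +-homo = fromℤ-+ ; *-homo = fromℤ-* ; -‿homo = fromℤ-neg
                 ; 0-homo = refl ; 1-homo = ⊕-identityʳ 1# }

    coefficient≟ : ∀ x y → Maybe (fromℤ x ≡ fromℤ y)
    coefficient≟ x y with x ℤ.≟ y
    ... | yes x≡y = just (cong fromℤ x≡y)
    ... | no  _   = nothing

  open Algebra.Solver.Ring ℤ.+-*-rawRing almostCommutativeRing ℤ⟶R coefficient≟ public
    using (solve; _:=_; _:+_; _:*_; _:-_; :-_; con)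

-- Order and the Archimedean property.

module Ordered (R : RealField) where
  open Field R

  ≺⇒0≺⊝ : ∀ {x y} → x ≺ y → 0# ≺ y ⊝ x
  ≺⇒0≺⊝ {x} {y} x≺y = subst (_≺ y ⊝ x) (⊕-inverseʳ x) (⊕-monoˡ-≺ (⊖ x) x≺y)

  0≺⊝⇒≺ : ∀ {x y} → 0# ≺ y ⊝ x → x ≺ y
  0≺⊝⇒≺ {x} {y} 0≺ = subst₂ _≺_ (⊕-identityˡ x) (solve 2 (λ x y → y :- x :+ x := y) refl x y) (⊕-monoˡ-≺ x 0≺)

  ≼⇒0≼⊝ : ∀ {x y} → x ≼ y → 0# ≼ y ⊝ x
  ≼⇒0≼⊝ (inj₁ x≺y)      = inj₁ (≺⇒0≺⊝ x≺y)
  ≼⇒0≼⊝ (inj₂ refl) = inj₂ (sym (⊕-inverseʳ _))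

  0≼⊝⇒≼ : ∀ {x y} → 0# ≼ y ⊝ x → x ≼ y
  0≼⊝⇒≼         (inj₁ 0≺) = inj₁ (0≺⊝⇒≺ 0≺)
  0≼⊝⇒≼ {x} {y} (inj₂ 0≡) = inj₂ (trans (sym (⊕-identityˡ x)) (trans (cong (_⊕ x) 0≡)
    (solve 2 (λ x y → y :- x :+ x := y) refl x y)))

  0≺+0≺ : ∀ {x y} → 0# ≺ x → 0# ≺ y → 0# ≺ x ⊕ y
  0≺+0≺ {x} {y} 0≺x 0≺y = ≺-trans 0≺y (subst (_≺ x ⊕ y) (⊕-identityˡ y) (⊕-monoˡ-≺ y 0≺x))

  0≺+0≼ : ∀ {x y} → 0# ≺ x → 0# ≼ y → 0# ≺ x ⊕ y
  0≺+0≼ 0≺x (inj₁ 0≺y)  = 0≺+0≺ 0≺x 0≺y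
  0≺+0≼ 0≺x (inj₂ refl) = subst (0# ≺_) (sym (⊕-identityʳ _)) 0≺x

  0≼+0≼ : ∀ {x y} → 0# ≼ x → 0# ≼ y → 0# ≼ x ⊕ y
  0≼+0≼ (inj₁ 0≺x)  0≼y = inj₁ (0≺+0≼ 0≺x 0≼y)
  0≼+0≼ (inj₂ refl) 0≼y = subst (0# ≼_) (sym (⊕-identityˡ _)) 0≼y

  0≼*0≼ : ∀ {x y} → 0# ≼ x → 0# ≼ y → 0# ≼ x ⊗ y
  0≼*0≼ (inj₁ 0≺x)  (inj₁ 0≺y)  = inj₁ (⊗-pos 0≺x 0≺y)
  0≼*0≼ (inj₂ refl) _           = inj₂ (sym (⊗-zeroˡ _))
  0≼*0≼ _           (inj₂ refl) = inj₂ (sym (⊗-zeroʳ _))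

  ≺-≼-trans : ∀ {x y z} → x ≺ y → y ≼ z → x ≺ z
  ≺-≼-trans x≺y (inj₁ y≺z)  = ≺-trans x≺y y≺z
  ≺-≼-trans x≺y (inj₂ refl) = x≺y

  ≼⇒⊁ : ∀ {x y} → x ≼ y → ¬ y ≺ x
  ≼⇒⊁ x≼y y≺x = ≺-irrefl _ (≺-≼-trans y≺x x≼y)

  ⊁⇒≼ : ∀ {x y} → ¬ y ≺ x → x ≼ y
  ⊁⇒≼ {x} {y} y⊀x with ≺-trichotomy x y
  ... | inj₁ x≺y        = inj₁ x≺y
  ... | inj₂ (inj₁ x≡y) = inj₂ x≡y
  ... | inj₂ (inj₂ y≺x) = contradiction y≺x y⊀x

  _≼?_ : ∀ x y → Dec (x ≼ y)
  x ≼? y with ≺-trichotomy x y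
  ... | inj₁ x≺y        = yes (inj₁ x≺y)
  ... | inj₂ (inj₁ x≡y) = yes (inj₂ x≡y)
  ... | inj₂ (inj₂ y≺x) = no λ x≼y → ≼⇒⊁ x≼y y≺x

  0≺1 : 0# ≺ 1#
  0≺1 with ≺-trichotomy 0# 1#
  ... | inj₁ 0≺1        = 0≺1
  ... | inj₂ (inj₁ 0≡1) = contradiction 0≡1 0≢1
  ... | inj₂ (inj₂ 1≺0) = contradiction (≺-trans 1≺0 (subst (0# ≺_) square (⊗-pos 0≺-1 0≺-1))) (≺-irrefl 1#)
    where
    0≺-1 : 0# ≺ 0# ⊝ 1#
    0≺-1 = ≺⇒0≺⊝ 1≺0
    square : (0# ⊝ 1#) ⊗ (0# ⊝ 1#) ≡ 1#
    square = trans (solve 1 (λ u → (con 0ℤ :- u) :* (con 0ℤ :- u) := u :* u) refl 1#) (⊗-identityˡ 1#)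

  0≺⊗⇒0≺ : ∀ {x s} → 0# ≺ s → 0# ≺ x ⊗ s → 0# ≺ x
  0≺⊗⇒0≺ {x} {s} 0≺s 0≺xs with ≺-trichotomy 0# x
  ... | inj₁ 0≺x         = 0≺x
  ... | inj₂ (inj₁ refl) = contradiction (subst (0# ≺_) (⊗-zeroˡ s) 0≺xs) (≺-irrefl 0#)
  ... | inj₂ (inj₂ x≺0)  = contradiction (⊗-pos (≺⇒0≺⊝ x≺0) 0≺s) (≼⇒⊁ (inj₁ (0≺⊝⇒≺
    (subst (0# ≺_) (solve 2 (λ x s → x :* s := con 0ℤ :- (con 0ℤ :- x) :* s) refl x s) 0≺xs))))

  0≼fromℕ : ∀ n → 0# ≼ fromℕ n
  0≼fromℕ zero    = inj₂ refl
  0≼fromℕ (suc n) = 0≼+0≼ (inj₁ 0≺1) (0≼fromℕ n)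

  0≺fromℕ[1+n] : ∀ n → 0# ≺ fromℕ (suc n)
  0≺fromℕ[1+n] n = 0≺+0≼ 0≺1 (0≼fromℕ n)

  fromℕ-mono-≤ : ∀ {m n} → m ≤ n → fromℕ m ≼ fromℕ n
  fromℕ-mono-≤ {m} {n} m≤n = 0≼⊝⇒≼ (subst (0# ≼_) (sym diff) (0≼fromℕ (n ∸ m)))
    where
    diff : fromℕ n ⊝ fromℕ m ≡ fromℕ (n ∸ m)
    diff = trans (cong (_⊝ fromℕ m) (trans (cong fromℕ (sym (m+[n∸m]≡n m≤n))) (fromℕ-+ m (n ∸ m))))
      (solve 2 (λ a b → a :+ b :- a := b) refl (fromℕ m) (fromℕ (n ∸ m)))

  fromℕ-cancel-< : ∀ {m n} → fromℕ m ≺ fromℕ n → m < n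
  fromℕ-cancel-< m≺n = ≰⇒> λ n≤m → ≼⇒⊁ (fromℕ-mono-≤ n≤m) m≺n

  -- If the naturals were bounded, they would have a supremum `σ`; since `suc n` is also a natural,
  -- `σ ⊝ 1#` would be a smaller upper bound. The doubly negated form suffices for refuting a cover.
  archimedean : ∀ x → ¬ (∀ n → ¬ x ≺ fromℕ n)
  archimedean x bounded with sup (λ y → ∃ λ n → y ≡ fromℕ n) (0# , 0 , refl) (x , λ { _ (n , refl) → ⊁⇒≼ (bounded n) })
  ... | σ , upper , least = ≼⇒⊁ (least (σ ⊝ 1#) λ { _ (n , refl) → 0≼⊝⇒≼ (subst (0# ≼_)
      (solve 3 (λ s n u → s :- (u :+ n) := (s :- u) :- n) refl σ (fromℕ n) 1#) (≼⇒0≼⊝ (upper _ (suc n , refl)))) })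
    (0≺⊝⇒≺ (subst (0# ≺_) (solve 2 (λ s u → u := s :- (s :- u)) refl σ 1#) 0≺1))

-- Rounding of triangles and affine coordinates.

module Geometry (R : RealField) where
  open Field R
  open Ordered R

  fromℕ-sum : ∀ x y z → fromℕ (x + y + z) ≡ fromℕ x ⊕ fromℕ y ⊕ fromℕ z
  fromℕ-sum x y z = trans (fromℕ-+ (x + y) z) (cong (_⊕ fromℕ z) (fromℕ-+ x y))

  -- A closed triangle of side less than N has at most N lattice points on each of its rows;
  -- this is why the corner can be rounded into the triangle at no cost.
  round-up : ∀ L N P Q → ∃ λ t → ∀ x y → x < L → y < L →
    P ≼ fromℕ x → Q ≼ fromℕ y → fromℕ x ⊕ fromℕ y ≺ P ⊕ Q ⊕ fromℕ N → Contains N t x y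
  round-up L N P Q
    with p , p-least ← bounded-least (λ x → P ≼ fromℕ x) (λ x → P ≼? fromℕ x) L
       | q , q-least ← bounded-least (λ y → Q ≼ fromℕ y) (λ y → Q ≼? fromℕ y) L
    = up p q , λ x y x<L y<L P≼x Q≼y x+y≺ →
        proj₁ (p-least x x<L P≼x) , proj₁ (q-least y y<L Q≼y) ,
        fromℕ-cancel-< (subst₂ _≺_ (sym (fromℕ-+ x y)) (sym (fromℕ-sum p q N)) (≺-≼-trans x+y≺
          (0≼⊝⇒≼ (subst (0# ≼_)
            (solve 5 (λ p q P Q N → (p :- P) :+ (q :- Q) := (p :+ q :+ N) :- (P :+ Q :+ N)) refl _ _ P Q (fromℕ N))
            (0≼+0≼ (≼⇒0≼⊝ (proj₂ (p-least x x<L P≼x))) (≼⇒0≼⊝ (proj₂ (q-least y y<L Q≼y))))))))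

  -- The mirror image: replacing `P` and `Q` by smaller integers only lowers the left side of the
  -- strict inequality, and the first two conditions survive because `p` and `q` are greatest.
  round-down : ∀ L N P Q → ∃ λ t → ∀ x y → x < L → y < L →
    fromℕ x ≼ P → fromℕ y ≼ Q → P ⊕ Q ≺ fromℕ x ⊕ fromℕ y ⊕ fromℕ N → Contains N t x y
  round-down L N P Q
    with p , p-greatest ← bounded-greatest (λ x → fromℕ x ≼ P) (λ x → fromℕ x ≼? P) L
       | q , q-greatest ← bounded-greatest (λ y → fromℕ y ≼ Q) (λ y → fromℕ y ≼? Q) L
    = down p q , λ x y x<L y<L x≼P y≼Q P+Q≺ →
        proj₁ (p-greatest x x<L x≼P) , proj₁ (q-greatest y y<L y≼Q) ,
        fromℕ-cancel-< (subst₂ _≺_ (sym (fromℕ-+ p q)) (sym (fromℕ-sum x y N)) (0≺⊝⇒≺ (subst (0# ≺_)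
          (solve 5 (λ p q P Q S → (S :- (P :+ Q)) :+ ((P :- p) :+ (Q :- q)) := S :- (p :+ q)) refl
            (fromℕ p) (fromℕ q) P Q (fromℕ x ⊕ fromℕ y ⊕ fromℕ N))
          (0≺+0≼ (≺⇒0≺⊝ P+Q≺)
            (0≼+0≼ (≼⇒0≼⊝ (proj₂ (p-greatest x x<L x≼P))) (≼⇒0≼⊝ (proj₂ (q-greatest y y<L y≼Q))))))))

  det : Point → Point → Carrier
  det (u₁ , u₂) (w₁ , w₂) = u₁ ⊗ w₂ ⊝ u₂ ⊗ w₁

  -- Taking the determinant of both sides with `w` removes the `w` terms; multiplying by `ι`, the
  -- inverse of `det u w`, isolates `x`.
  cramer : ∀ u w {x y e f g₁ g₂ ι} → det u w ⊗ ι ≡ 1# →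
    x ⊗ proj₁ u ⊕ y ⊗ proj₁ w ≡ e ⊗ proj₁ u ⊕ f ⊗ proj₁ w ⊕ g₁ →
    x ⊗ proj₂ u ⊕ y ⊗ proj₂ w ≡ e ⊗ proj₂ u ⊕ f ⊗ proj₂ w ⊕ g₂ →
    x ≡ e ⊕ det (g₁ , g₂) w ⊗ ι
  cramer (u₁ , u₂) (w₁ , w₂) {x} {y} {e} {f} {g₁} {g₂} {ι} Δι≡1 eq₁ eq₂ = begin
    x                                       ≡⟨ by-1 x ⟨
    x ⊗ (Δ ⊗ ι)                             ≡⟨ solve 7 (λ x y u₁ u₂ w₁ w₂ ι → x :* ((u₁ :* w₂ :- u₂ :* w₁) :* ι) :=
                                                 ((x :* u₁ :+ y :* w₁) :* w₂ :- (x :* u₂ :+ y :* w₂) :* w₁) :* ι)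
                                                 refl x y u₁ u₂ w₁ w₂ ι ⟩
    ((x ⊗ u₁ ⊕ y ⊗ w₁) ⊗ w₂ ⊝ (x ⊗ u₂ ⊕ y ⊗ w₂) ⊗ w₁) ⊗ ι
                                            ≡⟨ cong₂ (λ a b → (a ⊗ w₂ ⊝ b ⊗ w₁) ⊗ ι) eq₁ eq₂ ⟩
    ((e ⊗ u₁ ⊕ f ⊗ w₁ ⊕ g₁) ⊗ w₂ ⊝ (e ⊗ u₂ ⊕ f ⊗ w₂ ⊕ g₂) ⊗ w₁) ⊗ ι
                                            ≡⟨ solve 9 (λ e f g₁ g₂ u₁ u₂ w₁ w₂ ι →
                                                 ((e :* u₁ :+ f :* w₁ :+ g₁) :* w₂ :- (e :* u₂ :+ f :* w₂ :+ g₂) :* w₁) :* ι :=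
                                                 e :* ((u₁ :* w₂ :- u₂ :* w₁) :* ι) :+ (g₁ :* w₂ :- g₂ :* w₁) :* ι)
                                                 refl e f g₁ g₂ u₁ u₂ w₁ w₂ ι ⟩
    e ⊗ (Δ ⊗ ι) ⊕ det (g₁ , g₂) (w₁ , w₂) ⊗ ι  ≡⟨ cong (_⊕ det (g₁ , g₂) (w₁ , w₂) ⊗ ι) (by-1 e) ⟩
    e ⊕ det (g₁ , g₂) (w₁ , w₂) ⊗ ι            ∎
    where
    open ≡-Reasoning
    Δ = det (u₁ , u₂) (w₁ , w₂)
    by-1 : ∀ x → x ⊗ (Δ ⊗ ι) ≡ x
    by-1 x = trans (cong (x ⊗_) Δι≡1) (trans (⊗-comm x 1#) (⊗-identityˡ x))

  -- Since barycentric weights sum to 1, subtracting `a` expresses both representations of the point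
  -- through the edge vectors at `a`, one Cartesian coordinate at a time. The last term is the
  -- displacement of the vertex `a` under the homothety.
  relative : ∀ a b c {α β γ α′ β′ γ′ l t} → α ⊕ β ⊕ γ ≡ 1# → α′ ⊕ β′ ⊕ γ′ ≡ 1# →
    α ⊗ a ⊕ β ⊗ b ⊕ γ ⊗ c ≡ α′ ⊗ (l ⊗ a ⊕ t) ⊕ β′ ⊗ (l ⊗ b ⊕ t) ⊕ γ′ ⊗ (l ⊗ c ⊕ t) →
    β ⊗ (b ⊝ a) ⊕ γ ⊗ (c ⊝ a) ≡ (l ⊗ β′) ⊗ (b ⊝ a) ⊕ (l ⊗ γ′) ⊗ (c ⊝ a) ⊕ ((l ⊗ a ⊕ t) ⊝ a)
  relative a b c {α} {β} {γ} {α′} {β′} {γ′} {l} {t} σ≡1 σ′≡1 eq = begin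
    β ⊗ (b ⊝ a) ⊕ γ ⊗ (c ⊝ a)
      ≡⟨ solve 6 (λ a b c α β γ → β :* (b :- a) :+ γ :* (c :- a) :=
           (α :* a :+ β :* b :+ γ :* c) :- (α :+ β :+ γ) :* a) refl a b c α β γ ⟩
    (α ⊗ a ⊕ β ⊗ b ⊕ γ ⊗ c) ⊝ (α ⊕ β ⊕ γ) ⊗ a
      ≡⟨ cong₂ (λ p σ → p ⊝ σ ⊗ a) eq (trans σ≡1 (sym σ′≡1)) ⟩
    S ⊝ σ′ ⊗ a
      ≡⟨ solve 8 (λ a b c α β γ l t →
           (α :* (l :* a :+ t) :+ β :* (l :* b :+ t) :+ γ :* (l :* c :+ t)) :- (α :+ β :+ γ) :* a :=
           (l :* β) :* (b :- a) :+ (l :* γ) :* (c :- a) :+ ((α :+ β :+ γ) :* (l :* a :+ t) :- (α :+ β :+ γ) :* a))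
           refl a b c α′ β′ γ′ l t ⟩
    (l ⊗ β′) ⊗ (b ⊝ a) ⊕ (l ⊗ γ′) ⊗ (c ⊝ a) ⊕ (σ′ ⊗ (l ⊗ a ⊕ t) ⊝ σ′ ⊗ a)
      ≡⟨ cong ((l ⊗ β′) ⊗ (b ⊝ a) ⊕ (l ⊗ γ′) ⊗ (c ⊝ a) ⊕_) (cong₂ _⊝_ (by-1 (l ⊗ a ⊕ t)) (by-1 a)) ⟩
    (l ⊗ β′) ⊗ (b ⊝ a) ⊕ (l ⊗ γ′) ⊗ (c ⊝ a) ⊕ ((l ⊗ a ⊕ t) ⊝ a) ∎
    where
    open ≡-Reasoning
    S = α′ ⊗ (l ⊗ a ⊕ t) ⊕ β′ ⊗ (l ⊗ b ⊕ t) ⊕ γ′ ⊗ (l ⊗ c ⊕ t)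
    σ′ = α′ ⊕ β′ ⊕ γ′
    by-1 : ∀ x → σ′ ⊗ x ≡ x
    by-1 x = trans (cong (_⊗ x) σ′≡1) (⊗-identityˡ x)

  -- Heron's formula: (4 Area)² = 4 |u|² |w|² - (|u|² + |w|² - |u - w|²)², which is 3 s⁴ here.
  det≢0 : ∀ a₁ a₂ b₁ b₂ c₁ c₂ s → 0# ≺ s →
    dist² (a₁ , a₂) (b₁ , b₂) ≡ s ⊗ s → dist² (b₁ , b₂) (c₁ , c₂) ≡ s ⊗ s → dist² (c₁ , c₂) (a₁ , a₂) ≡ s ⊗ s →
    ¬ det (b₁ ⊝ a₁ , b₂ ⊝ a₂) (c₁ ⊝ a₁ , c₂ ⊝ a₂) ≡ 0#
  det≢0 a₁ a₂ b₁ b₂ c₁ c₂ s 0≺s ab bc ca det≡0 = ≺-irrefl 0# (subst (0# ≺_) (sym 0≡3s⁴) (0≺+0≺ (0≺+0≺ 0≺s⁴ 0≺s⁴) 0≺s⁴))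
    where
    u₁ = b₁ ⊝ a₁
    u₂ = b₂ ⊝ a₂
    w₁ = c₁ ⊝ a₁
    w₂ = c₂ ⊝ a₂
    s⁴ = (s ⊗ s) ⊗ (s ⊗ s)
    0≺s⁴ : 0# ≺ s⁴
    0≺s⁴ = ⊗-pos (⊗-pos 0≺s 0≺s) (⊗-pos 0≺s 0≺s)
    sq : ∀ x y → (x ⊝ y) ⊗ (x ⊝ y) ≡ (y ⊝ x) ⊗ (y ⊝ x)
    sq = solve 2 (λ x y → (x :- y) :* (x :- y) := (y :- x) :* (y :- x)) refl
    sq′ : ∀ a b c → (b ⊝ c) ⊗ (b ⊝ c) ≡ ((b ⊝ a) ⊝ (c ⊝ a)) ⊗ ((b ⊝ a) ⊝ (c ⊝ a))
    sq′ = solve 3 (λ a b c → (b :- c) :* (b :- c) := ((b :- a) :- (c :- a)) :* ((b :- a) :- (c :- a))) refl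
    |u|² : u₁ ⊗ u₁ ⊕ u₂ ⊗ u₂ ≡ s ⊗ s
    |u|² = trans (cong₂ _⊕_ (sq b₁ a₁) (sq b₂ a₂)) ab
    |w|² : w₁ ⊗ w₁ ⊕ w₂ ⊗ w₂ ≡ s ⊗ s
    |w|² = ca
    |u-w|² : (u₁ ⊝ w₁) ⊗ (u₁ ⊝ w₁) ⊕ (u₂ ⊝ w₂) ⊗ (u₂ ⊝ w₂) ≡ s ⊗ s
    |u-w|² = trans (sym (cong₂ _⊕_ (sq′ a₁ b₁ c₁) (sq′ a₂ b₂ c₂))) bc
    heron : Carrier → Carrier → Carrier → Carrier
    heron A B C = fromℤ (+ 4) ⊗ (A ⊗ B) ⊝ (A ⊕ B ⊝ C) ⊗ (A ⊕ B ⊝ C)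
    0≡3s⁴ : 0# ≡ s⁴ ⊕ s⁴ ⊕ s⁴
    0≡3s⁴ = begin
      0#
        ≡⟨ solve 0 (con 0ℤ := con (+ 4) :* (con 0ℤ :* con 0ℤ)) refl ⟩
      fromℤ (+ 4) ⊗ (0# ⊗ 0#)
        ≡⟨ cong (λ d → fromℤ (+ 4) ⊗ (d ⊗ d)) det≡0 ⟨
      fromℤ (+ 4) ⊗ (det (u₁ , u₂) (w₁ , w₂) ⊗ det (u₁ , u₂) (w₁ , w₂))
        ≡⟨ solve 4 (λ u₁ u₂ w₁ w₂ →
             let A = u₁ :* u₁ :+ u₂ :* u₂
                 B = w₁ :* w₁ :+ w₂ :* w₂
                 C = (u₁ :- w₁) :* (u₁ :- w₁) :+ (u₂ :- w₂) :* (u₂ :- w₂)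
             in con (+ 4) :* ((u₁ :* w₂ :- u₂ :* w₁) :* (u₁ :* w₂ :- u₂ :* w₁)) :=
                con (+ 4) :* (A :* B) :- (A :+ B :- C) :* (A :+ B :- C)) refl u₁ u₂ w₁ w₂ ⟩
      heron (u₁ ⊗ u₁ ⊕ u₂ ⊗ u₂) (w₁ ⊗ w₁ ⊕ w₂ ⊗ w₂) ((u₁ ⊝ w₁) ⊗ (u₁ ⊝ w₁) ⊕ (u₂ ⊝ w₂) ⊗ (u₂ ⊝ w₂))
        ≡⟨ cong₂ (λ A B → heron A B ((u₁ ⊝ w₁) ⊗ (u₁ ⊝ w₁) ⊕ (u₂ ⊝ w₂) ⊗ (u₂ ⊝ w₂))) |u|² |w|² ⟩
      heron (s ⊗ s) (s ⊗ s) ((u₁ ⊝ w₁) ⊗ (u₁ ⊝ w₁) ⊕ (u₂ ⊝ w₂) ⊗ (u₂ ⊝ w₂))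
        ≡⟨ cong (heron (s ⊗ s) (s ⊗ s)) |u-w|² ⟩
      heron (s ⊗ s) (s ⊗ s) (s ⊗ s)
        ≡⟨ solve 1 (λ q → con (+ 4) :* (q :* q) :- (q :+ q :- q) :* (q :+ q :- q) :=
             q :* q :+ q :* q :+ q :* q) refl (s ⊗ s) ⟩
      s⁴ ⊕ s⁴ ⊕ s⁴ ∎
      where open ≡-Reasoning

-- From unit triangles to lattice triangles.

module Covering (R : RealField) where
  open Field R
  open Ordered R
  open Geometry R

  IsUnit : Carrier → Carrier → Set
  IsUnit s l = l ⊗ s ≡ 1# ⊎ l ⊗ s ≡ ⊖ 1#

  private
    *-unit : ∀ κ {σ} → σ ≡ 1# → κ ⊗ σ ≡ κ
    *-unit κ σ≡1 = trans (cong (κ ⊗_) σ≡1) (trans (⊗-comm κ 1#) (⊗-identityˡ κ))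

    up-offset : ∀ κ β P → κ ⊗ β ≡ κ ⊗ β ⊕ P ⊝ P
    up-offset = solve 3 (λ κ β P → κ :* β := κ :* β :+ P :- P) refl

    down-offset : ∀ κ β P → κ ⊗ β ≡ P ⊝ (⊖ κ ⊗ β ⊕ P)
    down-offset = solve 3 (λ κ β P → κ :* β := P :- (:- κ :* β :+ P)) refl

    up-side : ∀ α β γ κ P Q N →
      (N ⊝ κ ⊗ (α ⊕ β ⊕ γ)) ⊕ κ ⊗ α ≡ (P ⊕ Q ⊕ N) ⊝ ((κ ⊗ β ⊕ P) ⊕ (κ ⊗ γ ⊕ Q))
    up-side = solve 7 (λ α β γ κ P Q N → (N :- κ :* (α :+ β :+ γ)) :+ κ :* α :=
      (P :+ Q :+ N) :- ((κ :* β :+ P) :+ (κ :* γ :+ Q))) refl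

    down-side : ∀ α β γ κ P Q N →
      (N ⊝ κ ⊗ (α ⊕ β ⊕ γ)) ⊕ κ ⊗ α ≡ ((⊖ κ ⊗ β ⊕ P) ⊕ (⊖ κ ⊗ γ ⊕ Q) ⊕ N) ⊝ (P ⊕ Q)
    down-side = solve 7 (λ α β γ κ P Q N → (N :- κ :* (α :+ β :+ γ)) :+ κ :* α :=
      ((:- κ :* β :+ P) :+ (:- κ :* γ :+ Q) :+ N) :- (P :+ Q)) refl

  private
    -- The gap in the third inequality is (N - κ) + κ α, strictly positive because κ < N.
    up-inequalities : ∀ {κ N P Q X Y α β γ} → 0# ≺ κ → κ ≺ N →
      0# ≼ α → 0# ≼ β → 0# ≼ γ → α ⊕ β ⊕ γ ≡ 1# → X ≡ κ ⊗ β ⊕ P → Y ≡ κ ⊗ γ ⊕ Q →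
      P ≼ X × Q ≼ Y × X ⊕ Y ≺ P ⊕ Q ⊕ N
    up-inequalities {κ} {N} {P} {Q} {_} {_} {α} {β} {γ} 0≺κ κ≺N 0≼α 0≼β 0≼γ σ≡1 refl refl =
      0≼⊝⇒≼ (subst (0# ≼_) (up-offset κ β P) (0≼*0≼ (inj₁ 0≺κ) 0≼β)) ,
      0≼⊝⇒≼ (subst (0# ≼_) (up-offset κ γ Q) (0≼*0≼ (inj₁ 0≺κ) 0≼γ)) ,
      0≺⊝⇒≺ (subst (0# ≺_) (up-side α β γ κ P Q N)
        (0≺+0≼ (≺⇒0≺⊝ (subst (_≺ N) (sym (*-unit κ σ≡1)) κ≺N)) (0≼*0≼ (inj₁ 0≺κ) 0≼α)))

    down-inequalities : ∀ {κ N P Q X Y α β γ} → 0# ≺ κ → κ ≺ N →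
      0# ≼ α → 0# ≼ β → 0# ≼ γ → α ⊕ β ⊕ γ ≡ 1# → X ≡ ⊖ κ ⊗ β ⊕ P → Y ≡ ⊖ κ ⊗ γ ⊕ Q →
      X ≼ P × Y ≼ Q × P ⊕ Q ≺ X ⊕ Y ⊕ N
    down-inequalities {κ} {N} {P} {Q} {_} {_} {α} {β} {γ} 0≺κ κ≺N 0≼α 0≼β 0≼γ σ≡1 refl refl =
      0≼⊝⇒≼ (subst (0# ≼_) (down-offset κ β P) (0≼*0≼ (inj₁ 0≺κ) 0≼β)) ,
      0≼⊝⇒≼ (subst (0# ≼_) (down-offset κ γ Q) (0≼*0≼ (inj₁ 0≺κ) 0≼γ)) ,
      0≺⊝⇒≺ (subst (0# ≺_) (down-side α β γ κ P Q N)
        (0≺+0≼ (≺⇒0≺⊝ (subst (_≺ N) (sym (*-unit κ σ≡1)) κ≺N)) (0≼*0≼ (inj₁ 0≺κ) 0≼α)))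

  -- `M ⊗ l` is the unit side measured in parts of length s / M. Multiplied by `s` it becomes `M`,
  -- so both bounds follow by cancelling `s`.
  unit-side : ∀ {s M N l} → 0# ≺ s → 0# ≺ M → M ≺ N ⊗ s → l ⊗ s ≡ 1# → 0# ≺ M ⊗ l × M ⊗ l ≺ N
  unit-side {s} {M} {N} {l} 0≺s 0≺M M≺Ns ls≡1 =
    0≺⊗⇒0≺ 0≺s (subst (0# ≺_) (sym Mls≡M) 0≺M) ,
    0≺⊝⇒≺ (0≺⊗⇒0≺ 0≺s (subst (0# ≺_) (trans (cong (N ⊗ s ⊝_) (sym Mls≡M))
      (solve 4 (λ N M l s → N :* s :- M :* l :* s := (N :- M :* l) :* s) refl N M l s)) (≺⇒0≺⊝ M≺Ns)))
    where
    Mls≡M : M ⊗ l ⊗ s ≡ M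
    Mls≡M = trans (⊗-assoc M l s) (trans (cong (M ⊗_) ls≡1) (trans (⊗-comm M 1#) (⊗-identityˡ M)))

  -- With (x , y) the coordinates of a point in units of 1 / M of the sides of the big triangle,
  -- a homothetic copy of ratio l consists of the points (M l β + P , M l γ + Q).
  Captures : ℕ → ℕ → Carrier → Carrier → Carrier → Tri → Set
  Captures L N λ′ P Q t = ∀ x y → x < L → y < L → ∀ {α β γ} → 0# ≼ α → 0# ≼ β → 0# ≼ γ → α ⊕ β ⊕ γ ≡ 1# →
    fromℕ x ≡ λ′ ⊗ β ⊕ P → fromℕ y ≡ λ′ ⊗ γ ⊕ Q → Contains N t x y

  unit-up : ∀ L N {κ} P Q → 0# ≺ κ → κ ≺ fromℕ N → ∃ (Captures L N κ P Q)
  unit-up L N P Q 0≺κ κ≺N = proj₁ (round-up L N P Q) , λ x y x<L y<L 0≼α 0≼β 0≼γ σ≡1 x≡ y≡ →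
    let P≼ , Q≼ , ≺N = up-inequalities 0≺κ κ≺N 0≼α 0≼β 0≼γ σ≡1 x≡ y≡
    in proj₂ (round-up L N P Q) x y x<L y<L P≼ Q≼ ≺N

  unit-down : ∀ L N {κ} P Q → 0# ≺ κ → κ ≺ fromℕ N → ∃ (Captures L N (⊖ κ) P Q)
  unit-down L N P Q 0≺κ κ≺N = proj₁ (round-down L N P Q) , λ x y x<L y<L 0≼α 0≼β 0≼γ σ≡1 x≡ y≡ →
    let ≼P , ≼Q , ≺N = down-inequalities 0≺κ κ≺N 0≼α 0≼β 0≼γ σ≡1 x≡ y≡
    in proj₂ (round-down L N P Q) x y x<L y<L ≼P ≼Q ≺N

  lattice-triangle : ∀ L N M {s l} P Q → 0# ≺ s → 0# ≺ M → M ≺ fromℕ N ⊗ s → IsUnit s l →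
    ∃ (Captures L N (M ⊗ l) P Q)
  lattice-triangle L N M P Q 0≺s 0≺M M≺Ns (inj₁ ls≡1) =
    let 0≺κ , κ≺N = unit-side 0≺s 0≺M M≺Ns ls≡1 in unit-up L N P Q 0≺κ κ≺N
  lattice-triangle L N M {s} {l} P Q 0≺s 0≺M M≺Ns (inj₂ ls≡-1) =
    -- A negative ratio is handled through the positive side length `M ⊗ ⊖ l`.
    subst (λ κ → ∃ (Captures L N κ P Q)) (double-neg M l)
      (let 0≺κ , κ≺N = unit-side 0≺s 0≺M M≺Ns -ls≡1 in unit-down L N P Q 0≺κ κ≺N)
    where
    -ls≡1 : ⊖ l ⊗ s ≡ 1#
    -ls≡1 = trans (sym (-‿distribˡ-* l s)) (trans (cong ⊖_ ls≡-1) (-‿involutive 1#))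
    double-neg : ∀ M l → ⊖ (M ⊗ ⊖ l) ≡ M ⊗ l
    double-neg = solve 2 (λ M l → :- (M :* :- l) := M :* l) refl

  det-swap : ∀ u w → det u w ≡ ⊖ det w u
  det-swap (u₁ , u₂) (w₁ , w₂) =
    solve 4 (λ u₁ u₂ w₁ w₂ → u₁ :* w₂ :- u₂ :* w₁ := :- (w₁ :* u₂ :- w₂ :* u₁)) refl u₁ u₂ w₁ w₂

  -- `M` is the number of parts on each side and `μ` is 1 / M; `M≺Ns` says that a unit side is
  -- shorter than `N` parts.
  module _ {a b c : Point} {s : Carrier} (0≺s : 0# ≺ s)
    (ab : dist² a b ≡ s ⊗ s) (bc : dist² b c ≡ s ⊗ s) (ca : dist² c a ≡ s ⊗ s)
    (L N M : ℕ) {μ : Carrier} (Mμ≡1 : fromℕ M ⊗ μ ≡ 1#)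
    (0≺M : 0# ≺ fromℕ M) (M≺Ns : fromℕ M ≺ fromℕ N ⊗ s) where

    private
      a₁ = proj₁ a
      a₂ = proj₂ a
      u w : Point
      u = proj₁ b ⊝ a₁ , proj₂ b ⊝ a₂
      w = proj₁ c ⊝ a₁ , proj₂ c ⊝ a₂
      Δ≢0 : ¬ det u w ≡ 0#
      Δ≢0 = det≢0 a₁ a₂ (proj₁ b) (proj₂ b) (proj₁ c) (proj₂ c) s 0≺s ab bc ca
      Δ′≢0 : ¬ det w u ≡ 0#
      Δ′≢0 Δ′≡0 = Δ≢0 (trans (det-swap u w)
        (trans (cong ⊖_ Δ′≡0) -0#≈0#))
      ι = proj₁ (⊗-inverse (det u w) Δ≢0)
      ι′ = proj₁ (⊗-inverse (det w u) Δ′≢0)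
      Δι≡1 = proj₂ (⊗-inverse (det u w) Δ≢0)
      Δ′ι′≡1 = proj₂ (⊗-inverse (det w u) Δ′≢0)

    lattice-point : (z x y : ℕ) → Point
    lattice-point z x y =
      (fromℕ z ⊗ μ ⊗ a₁ ⊕ fromℕ x ⊗ μ ⊗ proj₁ b ⊕ fromℕ y ⊗ μ ⊗ proj₁ c) ,
      (fromℕ z ⊗ μ ⊗ a₂ ⊕ fromℕ x ⊗ μ ⊗ proj₂ b ⊕ fromℕ y ⊗ μ ⊗ proj₂ c)

    barycentric : ∀ z x y → z + x + y ≡ M → fromℕ z ⊗ μ ⊕ fromℕ x ⊗ μ ⊕ fromℕ y ⊗ μ ≡ 1#
    barycentric z x y eq = trans (solve 4 (λ z x y μ → z :* μ :+ x :* μ :+ y :* μ := (z :+ x :+ y) :* μ) refl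
        (fromℕ z) (fromℕ x) (fromℕ y) μ)
      (trans (cong (_⊗ μ) (trans (sym (fromℕ-sum z x y)) (cong fromℕ eq))) Mμ≡1)

    0≼μ : 0# ≼ μ
    0≼μ = inj₁ (0≺⊗⇒0≺ 0≺M (subst (0# ≺_) (trans (sym Mμ≡1) (⊗-comm (fromℕ M) μ)) 0≺1))

    lattice-point-inside : ∀ z x y → z + x + y ≡ M → InTriangle a b c (lattice-point z x y)
    lattice-point-inside z x y eq = _ , _ , _ , 0≼*0≼ (0≼fromℕ z) 0≼μ , 0≼*0≼ (0≼fromℕ x) 0≼μ , 0≼*0≼ (0≼fromℕ y) 0≼μ ,
      barycentric z x y eq , refl , refl

    -- In the frame `u`, `w` at the vertex `a`, the lattice point has coordinates x / M and y / M,
    -- and as a point of the copy it has l β and l γ plus the coordinates of the displacement `g`.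
    -- Scaling by `M` gives the form required by `Captures`.
    discretise : ∀ l v → IsUnit s l → ∃ λ t → ∀ z x y → x < L → y < L → z + x + y ≡ M →
      InTriangle (homothety l v a) (homothety l v b) (homothety l v c) (lattice-point z x y) → Contains N t x y
    discretise l v unit = proj₁ triangle , contains
      where
      g : Point
      g = (l ⊗ a₁ ⊕ proj₁ v) ⊝ a₁ , (l ⊗ a₂ ⊕ proj₂ v) ⊝ a₂
      P = fromℕ M ⊗ (det g w ⊗ ι)
      Q = fromℕ M ⊗ (det g u ⊗ ι′)
      triangle = lattice-triangle L N (fromℕ M) P Q 0≺s 0≺M M≺Ns unit
      swap : ∀ {p q p′ q′ r} → p ⊕ q ≡ p′ ⊕ q′ ⊕ r → q ⊕ p ≡ q′ ⊕ p′ ⊕ r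
      swap {p} {q} {p′} {q′} {r} eq = trans (⊕-comm q p) (trans eq (cong (_⊕ r) (⊕-comm p′ q′)))
      scale : ∀ x β {P} → fromℕ x ⊗ μ ≡ l ⊗ β ⊕ P → fromℕ x ≡ fromℕ M ⊗ l ⊗ β ⊕ fromℕ M ⊗ P
      scale x β {P} eq = begin
        fromℕ x                             ≡⟨ ⊗-identityˡ _ ⟨
        1# ⊗ fromℕ x                        ≡⟨ cong (_⊗ fromℕ x) Mμ≡1 ⟨
        fromℕ M ⊗ μ ⊗ fromℕ x               ≡⟨ solve 3 (λ M μ x → M :* μ :* x := M :* (x :* μ)) refl (fromℕ M) μ (fromℕ x) ⟩
        fromℕ M ⊗ (fromℕ x ⊗ μ)             ≡⟨ cong (fromℕ M ⊗_) eq ⟩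
        fromℕ M ⊗ (l ⊗ β ⊕ P)               ≡⟨ solve 4 (λ M l β P → M :* (l :* β :+ P) := M :* l :* β :+ M :* P)
                                                 refl (fromℕ M) l β P ⟩
        fromℕ M ⊗ l ⊗ β ⊕ fromℕ M ⊗ P       ∎
        where open ≡-Reasoning
      contains : ∀ z x y → x < L → y < L → z + x + y ≡ M →
        InTriangle (homothety l v a) (homothety l v b) (homothety l v c) (lattice-point z x y) →
        Contains N (proj₁ triangle) x y
      contains z x y x<L y<L eq (α , β , γ , 0≼α , 0≼β , 0≼γ , σ≡1 , eq₁ , eq₂) =
        proj₂ triangle x y x<L y<L 0≼α 0≼β 0≼γ σ≡1
          (scale x β (cramer u w Δι≡1 rel₁ rel₂))
          -- Exchanging `u` and `w` lets the same rule isolate the other coordinate.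
          (scale y γ (cramer w u Δ′ι′≡1 (swap rel₁) (swap rel₂)))
        where
        rel₁ = relative a₁ (proj₁ b) (proj₁ c) (barycentric z x y eq) σ≡1 eq₁
        rel₂ = relative a₂ (proj₂ b) (proj₂ c) (barycentric z x y eq) σ≡1 eq₂

-- Choice of the subdivision.

theorem2 : (R : RealField) → (n : ℕ) → 1 ≤ n →
    (a b c : RealField.Point R) → (s : RealField.Carrier R) →
    RealField._<_ R (RealField.0# R) s →
    RealField._<_ R (RealField.fromℕ R n) s →
    RealField.dist² R a b ≡ RealField._*_ R s s →
    RealField.dist² R b c ≡ RealField._*_ R s s →
    RealField.dist² R c a ≡ RealField._*_ R s s →
    (ratio : Fin (n * n + 1) → RealField.Carrier R) →
    (shift : Fin (n * n + 1) → RealField.Point R) →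
    (∀ i → (RealField._*_ R (ratio i) s ≡ RealField.1# R) ⊎
    (RealField._*_ R (ratio i) s ≡ RealField.-_ R (RealField.1# R))) →
    ¬ (∀ p → RealField.InTriangle R a b c p →
    ∃ λ i → RealField.InTriangle R
    (RealField.homothety R (ratio i) (shift i) a)
    (RealField.homothety R (ratio i) (shift i) b)
    (RealField.homothety R (ratio i) (shift i) c) p)
theorem2 R (suc k) _ a b c s 0≺s n≺s ab bc ca ratio shift ratios cover =
  -- It is enough to refute the cover given a natural number `j` above 1 / ε.
  archimedean (proj₁ ε-inverse) refute
  where
  open Field R
  open Ordered R
  open Covering R
  n = suc k
  ε = s ⊝ fromℕ n
  0≺ε : 0# ≺ ε
  0≺ε = ≺⇒0≺⊝ n≺s
  ε-inverse : ∃ λ y → ε ⊗ y ≡ 1#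
  ε-inverse = ⊗-inverse ε λ ε≡0 → ≺-irrefl 0# (subst (0# ≺_) ε≡0 0≺ε)
  refute : ∀ j → ¬ proj₁ ε-inverse ≺ fromℕ j
  refute j ε⁻¹≺j = no-lattice-cover (suc j + d) k E F E+F≡2^e large covers
    where
    -- `K` exceeds `j` and hence 1 / ε; the exponent `suc j` also makes `K` at least 2, which gives
    -- `E ≤ N`.
    K = 2 ^ suc j
    -- With this exponent (n² + 2) N = d D < D², as `large` requires.
    d = (n * n + 2) * K
    D = 2 ^ d
    N = K * D
    -- A side cut into `M` parts has `M + 1` lattice points, so `L` is `suc M`.
    E = suc D
    F = N ∸ E
    M = n * N + D
    L = n * N + E
    E≤N : E ≤ N
    E≤N = begin
      1 + D            ≤⟨ +-monoˡ-≤ D (m^n>0 2 d) ⟩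
      D + D            ≡⟨ cong (_+_ D) (sym (+-identityʳ D)) ⟩
      2 * D            ≤⟨ *-monoˡ-≤ D (m≤m*n 2 (2 ^ j) {{m^n≢0 2 j}}) ⟩
      K * D            ∎
      where open ≤-Reasoning
    E+F≡N : E + F ≡ N
    E+F≡N = m+[n∸m]≡n E≤N
    E+F≡2^e : E + F ≡ 2 ^ (suc j + d)
    E+F≡2^e = trans E+F≡N (sym (^-distribˡ-+-* 2 (suc j) d))
    large : (n * n + 2) * (E + F) < 2 * (E * E)
    large = begin-strict
      (n * n + 2) * (E + F)  ≡⟨ cong ((n * n + 2) *_) E+F≡N ⟩
      (n * n + 2) * (K * D)  ≡⟨ *-assoc (n * n + 2) K D ⟨
      d * D                  ≤⟨ *-monoˡ-≤ D (<⇒≤ (n<2^n d)) ⟩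
      D * D                  <⟨ *-mono-< (n<1+n D) (n<1+n D) ⟩
      E * E                  ≤⟨ m≤m+n (E * E) _ ⟩
      2 * (E * E)            ∎
      where open ≤-Reasoning
    0≺M : 0# ≺ fromℕ M
    0≺M = ≺-≼-trans (0≺fromℕ[1+n] 0) (fromℕ-mono-≤ (≤-trans (m^n>0 2 d) (m≤n+m D (n * N))))
    0≺Kε-1 : 0# ≺ fromℕ K ⊗ ε ⊝ 1#
    0≺Kε-1 = subst (0# ≺_) (trans (expand (fromℕ K) ε _) (cong (fromℕ K ⊗ ε ⊝_) (proj₂ ε-inverse)))
      (⊗-pos (≺⇒0≺⊝ (≺-≼-trans ε⁻¹≺j (fromℕ-mono-≤ (<⇒≤ (<-trans (n<1+n j) (n<2^n (suc j))))))) 0≺ε)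
      where
      expand : ∀ K ε y → (K ⊝ y) ⊗ ε ≡ K ⊗ ε ⊝ ε ⊗ y
      expand = solve 3 (λ K ε y → (K :- y) :* ε := K :* ε :- ε :* y) refl
    M≺Ns : fromℕ M ≺ fromℕ N ⊗ s
    -- N s - M = D (K ε - 1), which is positive by the choice of `K`.
    M≺Ns = 0≺⊝⇒≺ (subst (0# ≺_) difference (⊗-pos (≺-≼-trans (0≺fromℕ[1+n] 0) (fromℕ-mono-≤ (m^n>0 2 d))) 0≺Kε-1))
      where
      collect : ∀ D K s n u → D ⊗ (K ⊗ (s ⊝ n) ⊝ u) ≡ K ⊗ D ⊗ s ⊝ (n ⊗ (K ⊗ D) ⊕ u ⊗ D)
      collect = solve 5 (λ D K s n u → D :* (K :* (s :- n) :- u) := K :* D :* s :- (n :* (K :* D) :+ u :* D)) refl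
      difference : fromℕ D ⊗ (fromℕ K ⊗ ε ⊝ 1#) ≡ fromℕ N ⊗ s ⊝ fromℕ M
      difference = trans (collect (fromℕ D) (fromℕ K) s (fromℕ n) 1#) (sym (cong₂ (λ N M → N ⊗ s ⊝ M) (fromℕ-* K D)
        (trans (fromℕ-+ (n * N) D) (cong₂ _⊕_ (trans (fromℕ-* n N) (cong (fromℕ n ⊗_) (fromℕ-* K D)))
          (sym (⊗-identityˡ _))))))
    M-inverse : ∃ λ μ → fromℕ M ⊗ μ ≡ 1#
    M-inverse = ⊗-inverse (fromℕ M) λ M≡0 → ≺-irrefl 0# (subst (0# ≺_) M≡0 0≺M)
    tri : ∀ i → _
    tri i = discretise {a} {b} {c} 0≺s ab bc ca L N M (proj₂ M-inverse) 0≺M M≺Ns (ratio i) (shift i) (ratios i)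
    covers′ : Covers N (λ i → proj₁ (tri i)) L
    covers′ x y x+y<L =
      let i , inside = cover _ (lattice-point-inside {a} {b} {c} 0≺s ab bc ca L N M (proj₂ M-inverse) 0≺M M≺Ns z x y z+x+y≡M)
      in i , proj₂ (tri i) z x y (≤-<-trans (m≤m+n x y) x+y<L) (≤-<-trans (m≤n+m y x) x+y<L) z+x+y≡M inside
      where
      -- The third barycentric numerator; the subtraction is exact because `x + y < L` means
      -- `x + y ≤ M`.
      z = M ∸ (x + y)
      z+x+y≡M : z + x + y ≡ M
      z+x+y≡M = trans (+-assoc z x y) (m∸n+n≡m (≤-pred (subst (x + y <_) (+-suc (n * N) D) x+y<L)))
    covers : Covers (E + F) (λ i → proj₁ (tri i)) (n * (E + F) + E)
    covers = subst (λ N → Covers N (λ i → proj₁ (tri i)) (n * N + E)) (sym E+F≡N) covers′
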